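{- For every $\varepsilon\in(0,1/4)$ and every $k\ge \varepsilon^{ -1}$, any (possibly randomized) two-player protocol for Max-Card-$k$ (in the two-player model described in the context) with an approximation guarantee of $\frac{2}{3}+\varepsilon$ must have communication complexity $\Omega\!\left(\frac{N\varepsilon}{k}\right)$ bits, where $N=|W|$ is the size of the ground set.
   Context: Two-player model for Max-Card-$k$. The global information known to both players consists of a positive integer $k$, a finite ground set $W$, and a partition $W=W_A\,\dot\cup\, W_B$. Alice privately receives a set $V_A\subseteq W_A$ and Bob privately receives a set $V_B\subseteq W_B$. There is a non-negative, monotone, submodular function $f:2^W\to\mathbb{R}_{\ge 0}$; Alice can query $f$ (via a value oracle) only on subsets of $W_A$ (in particular she may query sets of size larger than $k$), while Bob can query $f$ on any subset of $W$. A protocol consists of two possibly randomized algorithms: Alice's algorithm computes a message $m$ (a bit string) from the global information, $V_A$ and her oracle; then Bob's algorithm computes an output set $S\subseteq V_A\cup V_B$ with $|S|\le k$ from the global information, $V_B$, $m$ and his oracle. The communication complexity is the maximum length in bits of $m$ over all inputs and the randomness. The protocol has approximation guarantee $\rho$ if for every instance $\mathbb{E}[f(S)]\ge \rho\cdot\max\{f(T): T\subseteq V_A\cup V_B,\ |T|\le k\}$. -}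

module Defs where

open import Algebra.Bundles using (CommutativeRing)
open import Data.Bool.Base using (Bool)
open import Data.Fin.Base using (Fin)
open import Data.Fin.Subset using (Subset; ⊥; _⊆_; _∪_; _∩_; ∣_∣)
open import Data.Fin.Subset.Properties using (∪-idem; ∩-idem; drop-∷-⊆)
open import Data.List.Base using (List; length)
open import Data.Nat.Base using (ℕ; zero; suc; NonZero) renaming (_+_ to _+ℕ_; _≤_ to _≤ℕ_)
open import Data.Product.Base using (∃; _×_)
open import Data.Sum.Base using (_⊎_)
open import Data.Vec.Base using (Vec; []; _∷_; _++_; zipWith; here; there)
open import Level using (Level; _⊔_) renaming (suc to lsuc)
open import Relation.Binary.PropositionalEquality.Core using (_≡_; refl; trans; cong; subst₂)
open import Relation.Binary.Structures using (IsStrictPartialOrder)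
open import Relation.Nullary.Negation.Core using (¬_)
import Algebra.Properties.Semiring.Sum as SemiringSum
import Algebra.Definitions.RawMonoid as RawMonoidDefinitions

-- Phrased with cotransitivity instead of trichotomy, so that constructive reals
-- are covered as well; with excluded middle these are the usual ordered fields.
record OrderedField (c ℓ : Level) : Set (lsuc (c ⊔ ℓ)) where
  infix 4 _<_ _≤_
  infixl 7 _/ℕ_

  field
    commutativeRing : CommutativeRing c ℓ

  open CommutativeRing commutativeRing public
    renaming (refl to ≈-refl; sym to ≈-sym; trans to ≈-trans)

  field
    _<_                    : Carrier → Carrier → Set ℓ
    <-isStrictPartialOrder : IsStrictPartialOrder _≈_ _<_
    <-cotransitive         : ∀ {x y} → x < y → ∀ z → (x < z) ⊎ (z < y)
    <-tight                : ∀ {x y} → ¬ (x < y) → ¬ (y < x) → x ≈ y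
    0<1                    : 0# < 1#
    +-monoˡ-<              : ∀ {x y} z → x < y → x + z < y + z
    *-pos                  : ∀ {x y} → 0# < x → 0# < y → 0# < x * y
    inv                    : ∀ x → 0# < x → Carrier
    *-inverseʳ             : ∀ x (0<x : 0# < x) → x * inv x 0<x ≈ 1#

  open IsStrictPartialOrder <-isStrictPartialOrder public
    using (<-respˡ-≈; <-respʳ-≈)
    renaming (trans to <-trans; irrefl to <-irrefl; asym to <-asym)

  _≤_ : Carrier → Carrier → Set ℓ
  x ≤ y = ¬ (y < x)

  fromℕ : ℕ → Carrier
  fromℕ n = n ×ᴹ 1#
    where open RawMonoidDefinitions +-rawMonoid using () renaming (_×_ to _×ᴹ_)

  fromℕ-pos : ∀ n → 0# < fromℕ (suc n)
  fromℕ-pos zero    = <-respʳ-≈ (≈-sym (+-identityʳ 1#)) 0<1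
  fromℕ-pos (suc n) =
    <-trans (fromℕ-pos n)
      (<-respˡ-≈ (+-identityˡ (fromℕ (suc n))) (+-monoˡ-< (fromℕ (suc n)) 0<1))

  _/ℕ_ : Carrier → (n : ℕ) .{{_ : NonZero n}} → Carrier
  x /ℕ (suc n) = x * inv (fromℕ (suc n)) (fromℕ-pos n)

-- ℝ as a Cauchy-complete Archimedean ordered field, which classically
-- characterises it up to isomorphism.
record RealNumbers (c ℓ : Level) : Set (lsuc (c ⊔ ℓ)) where
  field
    orderedField : OrderedField c ℓ

  open OrderedField orderedField public

  field
    archimedean : ∀ x → ∃ λ n → x < fromℕ n
    complete    : ∀ (u : ℕ → Carrier) →
      (∀ δ → 0# < δ → ∃ λ M → ∀ m n → M ≤ℕ m → M ≤ℕ n → u m - u n < δ) →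
      ∃ λ l → ∀ δ → 0# < δ → ∃ λ M → ∀ n → M ≤ℕ n → (u n - l < δ) × (l - u n < δ)

++⊥-⊆ : ∀ {a} b {S T : Subset a} → S ⊆ T → (S ++ ⊥ {b}) ⊆ (T ++ ⊥ {b})
++⊥-⊆ b {[]}    {[]}    S⊆T x∈ = x∈
++⊥-⊆ b {_ ∷ S} {_ ∷ T} S⊆T here with S⊆T here
... | here = here
++⊥-⊆ b {_ ∷ S} {_ ∷ T} S⊆T (there x∈) =
  there (++⊥-⊆ b {S} {T} (drop-∷-⊆ S⊆T) x∈)

zipWith-++ : ∀ {m n} (_∙_ : Bool → Bool → Bool) (xs ys : Vec Bool m) (us vs : Vec Bool n) →
  zipWith _∙_ (xs ++ us) (ys ++ vs) ≡ zipWith _∙_ xs ys ++ zipWith _∙_ us vs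
zipWith-++ _∙_ []       []       us vs = refl
zipWith-++ _∙_ (x ∷ xs) (y ∷ ys) us vs = cong ((x ∙ y) ∷_) (zipWith-++ _∙_ xs ys us vs)

module TwoPlayer {c ℓ : Level} (ℝ : RealNumbers c ℓ) where

  open RealNumbers ℝ
  open SemiringSum semiring using (sum)

  record SubmodularFunction (n : ℕ) : Set (c ⊔ ℓ) where
    field
      value       : Subset n → Carrier
      nonNegative : ∀ S → 0# ≤ value S
      monotone    : ∀ S T → S ⊆ T → value S ≤ value T
      submodular  : ∀ S T → value (S ∪ T) + value (S ∩ T) ≤ value S + value T

  open SubmodularFunction public

  infix 4 _≈ᶠ_
  _≈ᶠ_ : ∀ {n} → SubmodularFunction n → SubmodularFunction n → Set ℓ
  f ≈ᶠ g = ∀ S → value f S ≈ value g S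

  -- The ground set W = W_A ∪̇ W_B is Fin (a + b), with W_A the first a and W_B
  -- the last b elements.  Hence V_A ∪ V_B is V_A ++ V_B, and a subset S of W_A
  -- is S ++ ⊥ when seen as a subset of W.
  restrictᴬ : ∀ a b → SubmodularFunction (a +ℕ b) → SubmodularFunction a
  restrictᴬ a b f = record
    { value       = λ S → value f (S ++ ⊥ {b})
    ; nonNegative = λ S → nonNegative f (S ++ ⊥)
    ; monotone    = λ S T S⊆T → monotone f (S ++ ⊥) (T ++ ⊥) (++⊥-⊆ b {S} {T} S⊆T)
    ; submodular  = λ S T → subst₂
        (λ P Q → value f P + value f Q ≤ value f (S ++ ⊥) + value f (T ++ ⊥))
        (trans (zipWith-++ _ S T ⊥ ⊥) (cong ((S ∪ T) ++_) (∪-idem ⊥)))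
        (trans (zipWith-++ _ S T ⊥ ⊥) (cong ((S ∩ T) ++_) (∩-idem ⊥)))
        (submodular f (S ++ ⊥) (T ++ ⊥))
    }

  -- Random variables on a finite probability space with real probabilities.
  -- Every distribution on a finite set (bit strings of bounded length, subsets
  -- of W) arises in this way.
  record Random {a} (A : Set a) : Set (a ⊔ c ⊔ ℓ) where
    field
      size        : ℕ
      prob        : Fin size → Carrier
      prob-nonNeg : ∀ i → 0# ≤ prob i
      prob-total  : sum prob ≈ 1#
      outcome     : Fin size → A

  open Random public

  module _ {a} {A : Set a} where

    𝔼 : Random A → (A → Carrier) → Carrier
    𝔼 d X = sum (λ i → prob d i * X (outcome d i))

    Possible : Random A → A → Set (a ⊔ ℓ)
    Possible d x = ∃ λ i → (0# < prob d i) × (outcome d i ≡ x)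

    SameLaw : Random A → Random A → Set (a ⊔ c ⊔ ℓ)
    SameLaw d e = ∀ X → 𝔼 d X ≈ 𝔼 e X

  Message : Set
  Message = List Bool

  Feasible : ∀ (k : ℕ) {n} → Subset n → Subset n → Set
  Feasible k V S = (S ⊆ V) × (∣ S ∣ ≤ℕ k)

  IsOptimum : ∀ (k : ℕ) {n} → SubmodularFunction n → Subset n → Carrier → Set ℓ
  IsOptimum k f V v =
    (∃ λ T → Feasible k V T × (value f T ≈ v)) × (∀ T → Feasible k V T → value f T ≤ v)

  -- The players use private coins and may make unboundedly many adaptive oracle
  -- queries, so the law of what each one produces is an arbitrary function of
  -- the global information, the private set and the values of the accessible
  -- part of f; the two SameLaw fields say that nothing beyond those values is
  -- used.
  record Protocol (k : ℕ) : Set (c ⊔ ℓ) where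
    field
      alice : ∀ a b → Subset a → SubmodularFunction a → Random Message
      bob   : ∀ a b → Subset b → Message → SubmodularFunction (a +ℕ b) → Random (Subset (a +ℕ b))

      alice-oracle : ∀ a b V_A {f g} → f ≈ᶠ g →
        SameLaw (alice a b V_A f) (alice a b V_A g)
      bob-oracle   : ∀ a b V_B m {f g} → f ≈ᶠ g →
        SameLaw (bob a b V_B m f) (bob a b V_B m g)

      feasible : ∀ a b V_A V_B f m S →
        Possible (alice a b V_A (restrictᴬ a b f)) m →
        Possible (bob a b V_B m f) S →
        Feasible k (V_A ++ V_B) S

    expectedValue : ∀ a b → Subset a → Subset b → SubmodularFunction (a +ℕ b) → Carrier
    expectedValue a b V_A V_B f =
      𝔼 (alice a b V_A (restrictᴬ a b f)) λ m → 𝔼 (bob a b V_B m f) (value f)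

  open Protocol public

  ApproximationGuarantee : ∀ {k} → Protocol k → Carrier → Set (c ⊔ ℓ)
  ApproximationGuarantee {k} P ρ =
    ∀ a b V_A V_B f opt → IsOptimum k f (V_A ++ V_B) opt →
    ρ * opt ≤ expectedValue P a b V_A V_B f

  -- On ground sets of size N no message is longer than C bits, whatever the
  -- partition, the input and the coins.
  CommunicationAtMost : ∀ {k} → Protocol k → ℕ → ℕ → Set (c ⊔ ℓ)
  CommunicationAtMost P N C =
    ∀ a b → a +ℕ b ≡ N → ∀ V_A (f : SubmodularFunction (a +ℕ b)) m →
    Possible (alice P a b V_A (restrictᴬ a b f)) m → length m ≤ℕ C

{-# OPTIONS --safe #-}

-- Write K = k − 1.  Alice's elements are arranged in n pairs of groups with K
-- elements each, one per layer, and Bob owns a single element w.  Inside a layer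
-- f is the rank function of lines and a point w in the projective plane, where w
-- lies on all lines except the one of a special group q.  Alice only sees
-- min (3, 2 · #lines), which does not reveal q.  The group q together with w has
-- value 3K, whereas a set of size k that misses q has value at most 2K + 1.
--
-- Alice gets one group (i , x i) of each pair.  Since Bob may only output elements
-- that Alice owns, the groups he possibly hits after reading a message m form a
-- partial assignment T m, and x extends T m whenever x can lead to m.  There are
-- fewer than 2 ^ (C + 1) messages, so some x extends no T m of size above C.  For
-- this x, adding up the guarantee over the n choices of q = (i , x i) yields
-- n (2/3 + ε) 3K ≤ n (2K + 1) + C K, whence n ε ≤ C because 1 ≤ k ε.
module Submission where

open import Data.Bool.Base using (Bool; true; false; if_then_else_; _∧_; not)
import Data.Bool.Properties as Bool
open import Data.Fin.Base using (Fin; zero; suc; _↑ˡ_; combine; remQuot) renaming (splitAt to splitAtᶠ)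
import Data.Fin.Properties as Fin
open import Data.Fin.Subset using (Subset; inside; outside; ⊥; ⊤; ⁅_⁆; _∈_; _⊆_; _∪_; _∩_; ∣_∣)
open import Data.Fin.Subset.Properties
  using (drop-∷-⊆; p∩q⊆p; p∩q⊆q; p⊆p∪q; q⊆p∪q; p⊆q⇒∣p∣≤∣q∣; x∈⁅x⁆; x∈⁅y⁆⇒x≡y; ∣⁅x⁆∣≡1; ∣⊥∣≡0; ∉⊥; x∈p∪q⁻)
open import Data.List.Base as List using (List; []; _∷_; length)
import Data.List.Properties as List
open import Data.List.Membership.Propositional using () renaming (_∈_ to _∈ᴸ_)
open import Data.List.Membership.Propositional.Properties using (∈-map⁺; ∈-++⁺ˡ; ∈-++⁺ʳ; ∈-filter⁺)
open import Data.List.Relation.Unary.All as All using (All; []; _∷_)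
import Data.List.Relation.Unary.All.Properties as All
open import Data.List.Relation.Unary.Any using (here; there)
open import Data.Maybe.Base using (Maybe; just; nothing)
open import Data.Nat.Base as ℕ using (ℕ; zero; suc; s≤s; z≤n; NonZero)
import Data.Nat.DivMod as ℕ
import Data.Nat.Properties as ℕ
open import Data.Nat.Solver using () renaming (module +-*-Solver to ℕSolver)
open import Data.Product.Base using (∃; _×_; _,_; proj₁; proj₂; map₂)
import Data.Product.Properties as Product
open import Data.Sum.Base using (inj₁; inj₂; [_,_]′)
open import Data.Vec.Base using (Vec; []; _∷_; _++_; lookup; tabulate; splitAt; here; there)
open import Data.Vec.Functional using () renaming (_∷_ to _∷ᶠ_)
open import Data.Vec.Properties using (lookup∘tabulate; lookup-++ˡ; []=⇒lookup; lookup⇒[]=)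
open import Function.Base using (_∘_; const; id; case_of_)
open import Function.Bundles using (module Inverse)
open import Relation.Binary.Bundles using (Preorder)
open import Relation.Binary.Definitions using (DecidableEquality)
open import Relation.Binary.PropositionalEquality
  using (_≡_; _≢_; refl; sym; trans; cong; cong₂; subst; subst₂; module ≡-Reasoning)
open import Relation.Nullary.Decidable using (Dec; yes; no; does; dec-true; dec-false; decidable-stable)
open import Relation.Nullary.Negation using (¬_; contradiction)
import Algebra.Properties.Semiring.Sum as SemiringSum
import Algebra.Solver.Ring.NaturalCoefficients.Default as Solver
import Relation.Binary.Reasoning.Preorder as PreorderReasoning
import Relation.Binary.Reasoning.Setoid as SetoidReasoning
open import Defs

-- Monotone submodular functions with values in the natural numbers.

module SubmodularRanks where
  open import Data.Nat.Base using (_+_; _*_; _⊓_; _≤_)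
  open import Algebra.Properties.CommutativeSemigroup ℕ.+-commutativeSemigroup using (interchange; x∙yz≈y∙xz)
  open import Algebra.Properties.CommutativeMonoid.Sum ℕ.+-0-commutativeMonoid public
    using (sum; sum-cong-≗; ∑-distrib-+)

  sum-mono-≤ : ∀ {n} {g h : Fin n → ℕ} → (∀ i → g i ≤ h i) → sum g ≤ sum h
  sum-mono-≤ {zero}  g≤h = z≤n
  sum-mono-≤ {suc n} g≤h = ℕ.+-mono-≤ (g≤h zero) (sum-mono-≤ (g≤h ∘ suc))

  sum-const : ∀ n c → sum {n} (const c) ≡ n * c
  sum-const zero    c = refl
  sum-const (suc n) c = cong (c +_) (sum-const n c)

  linear : ∀ {n} → Vec ℕ n → Subset n → ℕ
  linear []      []            = 0
  linear (w ∷ ω) (inside  ∷ S) = w + linear ω S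
  linear (w ∷ ω) (outside ∷ S) = linear ω S

  linear-modular : ∀ {n} (ω : Vec ℕ n) S T →
    linear ω (S ∪ T) + linear ω (S ∩ T) ≡ linear ω S + linear ω T
  linear-modular []      []            []            = refl
  linear-modular (w ∷ ω) (inside  ∷ S) (inside  ∷ T) = begin
    (w + linear ω (S ∪ T)) + (w + linear ω (S ∩ T)) ≡⟨ interchange w _ w _ ⟩
    (w + w) + (linear ω (S ∪ T) + linear ω (S ∩ T)) ≡⟨ cong ((w + w) +_) (linear-modular ω S T) ⟩
    (w + w) + (linear ω S + linear ω T)             ≡⟨ interchange w w _ _ ⟩
    (w + linear ω S) + (w + linear ω T)             ∎
    where open ≡-Reasoning
  linear-modular (w ∷ ω) (inside  ∷ S) (outside ∷ T) = begin
    (w + linear ω (S ∪ T)) + linear ω (S ∩ T) ≡⟨ ℕ.+-assoc w _ _ ⟩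
    w + (linear ω (S ∪ T) + linear ω (S ∩ T)) ≡⟨ cong (w +_) (linear-modular ω S T) ⟩
    w + (linear ω S + linear ω T)             ≡⟨ ℕ.+-assoc w _ _ ⟨
    (w + linear ω S) + linear ω T             ∎
    where open ≡-Reasoning
  linear-modular (w ∷ ω) (outside ∷ S) (inside  ∷ T) = begin
    (w + linear ω (S ∪ T)) + linear ω (S ∩ T) ≡⟨ ℕ.+-assoc w _ _ ⟩
    w + (linear ω (S ∪ T) + linear ω (S ∩ T)) ≡⟨ cong (w +_) (linear-modular ω S T) ⟩
    w + (linear ω S + linear ω T)             ≡⟨ x∙yz≈y∙xz w (linear ω S) (linear ω T) ⟩
    linear ω S + (w + linear ω T)             ∎
    where open ≡-Reasoning
  linear-modular (w ∷ ω) (outside ∷ S) (outside ∷ T) = linear-modular ω S T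

  linear-monotone : ∀ {n} (ω : Vec ℕ n) S T → S ⊆ T → linear ω S ≤ linear ω T
  linear-monotone []      []            []            S⊆T = z≤n
  linear-monotone (w ∷ ω) (inside  ∷ S) (inside  ∷ T) S⊆T =
    ℕ.+-monoʳ-≤ w (linear-monotone ω S T (drop-∷-⊆ S⊆T))
  linear-monotone (w ∷ ω) (inside  ∷ S) (outside ∷ T) S⊆T with () ← S⊆T here
  linear-monotone (w ∷ ω) (outside ∷ S) (inside  ∷ T) S⊆T =
    ℕ.≤-trans (linear-monotone ω S T (drop-∷-⊆ S⊆T)) (ℕ.m≤n+m _ w)
  linear-monotone (w ∷ ω) (outside ∷ S) (outside ∷ T) S⊆T =
    linear-monotone ω S T (drop-∷-⊆ S⊆T)

  linear-++ : ∀ {m n} (ω : Vec ℕ m) (ω′ : Vec ℕ n) S T →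
    linear (ω ++ ω′) (S ++ T) ≡ linear ω S + linear ω′ T
  linear-++ []      ω′ []            T = refl
  linear-++ (w ∷ ω) ω′ (inside  ∷ S) T =
    trans (cong (w +_) (linear-++ ω ω′ S T)) (sym (ℕ.+-assoc w _ _))
  linear-++ (w ∷ ω) ω′ (outside ∷ S) T = linear-++ ω ω′ S T

  lookup≤linear : ∀ {n} (ω : Vec ℕ n) {S x} → x ∈ S → lookup ω x ≤ linear ω S
  lookup≤linear (w ∷ ω) here = ℕ.m≤m+n w _
  lookup≤linear (w ∷ ω) {inside  ∷ S} (there x∈S) = ℕ.≤-trans (lookup≤linear ω x∈S) (ℕ.m≤n+m _ w)
  lookup≤linear (w ∷ ω) {outside ∷ S} (there x∈S) = lookup≤linear ω x∈S

  linear≡0 : ∀ {n} (ω : Vec ℕ n) S → (∀ x → x ∈ S → lookup ω x ≡ 0) → linear ω S ≡ 0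
  linear≡0 []      []            z = refl
  linear≡0 (w ∷ ω) (inside  ∷ S) z = cong₂ _+_ (z zero here) (linear≡0 ω S λ x → z (suc x) ∘ there)
  linear≡0 (w ∷ ω) (outside ∷ S) z = linear≡0 ω S λ x → z (suc x) ∘ there

  linear-tabulate-+ : ∀ {n} (g h : Fin n → ℕ) S →
    linear (tabulate λ x → g x + h x) S ≡ linear (tabulate g) S + linear (tabulate h) S
  linear-tabulate-+ g h []            = refl
  linear-tabulate-+ g h (inside  ∷ S) =
    trans (cong (g zero + h zero +_) (linear-tabulate-+ (g ∘ suc) (h ∘ suc) S))
          (interchange (g zero) (h zero) _ _)
  linear-tabulate-+ g h (outside ∷ S) = linear-tabulate-+ (g ∘ suc) (h ∘ suc) S

  linear-tabulate-cong : ∀ {n} {g h : Fin n → ℕ} → (∀ x → g x ≡ h x) → ∀ S →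
    linear (tabulate g) S ≡ linear (tabulate h) S
  linear-tabulate-cong g≗h []            = refl
  linear-tabulate-cong g≗h (inside  ∷ S) = cong₂ _+_ (g≗h zero) (linear-tabulate-cong (g≗h ∘ suc) S)
  linear-tabulate-cong g≗h (outside ∷ S) = linear-tabulate-cong (g≗h ∘ suc) S

  ones : ∀ {n} → Vec ℕ n
  ones = tabulate (const 1)

  linear-ones : ∀ {n} (S : Subset n) → linear ones S ≡ ∣ S ∣
  linear-ones []            = refl
  linear-ones (inside  ∷ S) = cong suc (linear-ones S)
  linear-ones (outside ∷ S) = linear-ones S

  ∣p∪q∣≤∣p∣+∣q∣ : ∀ {n} (p q : Subset n) → ∣ p ∪ q ∣ ≤ ∣ p ∣ + ∣ q ∣
  ∣p∪q∣≤∣p∣+∣q∣ p q = begin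
    ∣ p ∪ q ∣                               ≡⟨ linear-ones (p ∪ q) ⟨
    linear ones (p ∪ q)                      ≤⟨ ℕ.m≤m+n _ _ ⟩
    linear ones (p ∪ q) + linear ones (p ∩ q) ≡⟨ linear-modular ones p q ⟩
    linear ones p + linear ones q            ≡⟨ cong₂ _+_ (linear-ones p) (linear-ones q) ⟩
    ∣ p ∣ + ∣ q ∣                             ∎
    where open ℕ.≤-Reasoning

  ∣++∣ : ∀ {m n} (S : Subset m) (T : Subset n) → ∣ S ++ T ∣ ≡ ∣ S ∣ + ∣ T ∣
  ∣++∣ []            T = refl
  ∣++∣ (inside  ∷ S) T = cong suc (∣++∣ S T)
  ∣++∣ (outside ∷ S) T = ∣++∣ S T

  image : ∀ {L a} → (Fin L → Fin a) → Subset a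
  image {zero}  e = ⊥
  image {suc L} e = ⁅ e zero ⁆ ∪ image (e ∘ suc)

  ∈-image : ∀ {L a} (e : Fin L → Fin a) t → e t ∈ image e
  ∈-image e zero    = p⊆p∪q _ (x∈⁅x⁆ (e zero))
  ∈-image e (suc t) = q⊆p∪q ⁅ e zero ⁆ _ (∈-image (e ∘ suc) t)

  image⁻ : ∀ {L a} (e : Fin L → Fin a) {p} → p ∈ image e → ∃ λ t → p ≡ e t
  image⁻ {zero}  e p∈ = contradiction p∈ ∉⊥
  image⁻ {suc L} e p∈ with x∈p∪q⁻ ⁅ e zero ⁆ (image (e ∘ suc)) p∈
  ... | inj₁ p∈₁ = zero , x∈⁅y⁆⇒x≡y (e zero) p∈₁
  ... | inj₂ p∈₂ = let t , eq = image⁻ (e ∘ suc) p∈₂ in suc t , eq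

  ∣image∣ : ∀ {L a} (e : Fin L → Fin a) → ∣ image e ∣ ≤ L
  ∣image∣ {zero}  {a} e = ℕ.≤-reflexive (∣⊥∣≡0 a)
  ∣image∣ {suc L} {a} e = ℕ.≤-trans (∣p∪q∣≤∣p∣+∣q∣ ⁅ e zero ⁆ _)
    (ℕ.+-mono-≤ (ℕ.≤-reflexive (∣⁅x⁆∣≡1 (e zero))) (∣image∣ (e ∘ suc)))

  ++-mono-⊆ : ∀ {m n} {S T : Subset m} {U : Subset n} → S ⊆ T → S ++ U ⊆ T ++ U
  ++-mono-⊆ {S = []}    {[]}    S⊆T x∈ = x∈
  ++-mono-⊆ {S = _ ∷ S} {_ ∷ T} S⊆T here with here ← S⊆T here = here
  ++-mono-⊆ {S = _ ∷ S} {_ ∷ T} S⊆T (there x∈) = there (++-mono-⊆ (drop-∷-⊆ S⊆T) x∈)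

  indicator : Bool → ℕ
  indicator b = if b then 1 else 0

  sum-indicator-≟ : ∀ {K} (c : Fin K) → sum (λ t → indicator (does (c Fin.≟ t))) ≡ 1
  sum-indicator-≟ {suc K} zero    = cong suc (trans (sum-const K 0) (ℕ.*-zeroʳ K))
  sum-indicator-≟ {suc K} (suc c) = trans (sum-cong-≗ {K} λ t → refl) (sum-indicator-≟ c)

  -- Double counting: every element of `S` is counted in exactly one class.
  sum-linear-classes : ∀ {n K} (class : Fin n → Fin K) S →
    sum (λ t → linear (tabulate λ x → indicator (does (class x Fin.≟ t))) S) ≡ ∣ S ∣
  sum-linear-classes {K = K} class []            = trans (sum-const K 0) (ℕ.*-zeroʳ K)
  sum-linear-classes {K = K} class (inside  ∷ S) = trans
    (∑-distrib-+ {K} (λ t → indicator (does (class zero Fin.≟ t))) _)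
    (cong₂ _+_ (sum-indicator-≟ (class zero)) (sum-linear-classes (class ∘ suc) S))
  sum-linear-classes {K = K} class (outside ∷ S) = sum-linear-classes (class ∘ suc) S

  -- The hard functions are built over the naturals, and `realize` carries them into the reals.
  record Rank (n : ℕ) : Set where
    field
      rank            : Subset n → ℕ
      rank-monotone   : ∀ S T → S ⊆ T → rank S ≤ rank T
      rank-submodular : ∀ S T → rank (S ∪ T) + rank (S ∩ T) ≤ rank S + rank T

  open Rank public

  modular : ∀ {n} → Vec ℕ n → Rank n
  modular ω = record
    { rank            = linear ω
    ; rank-monotone   = linear-monotone ω
    ; rank-submodular = λ S T → ℕ.≤-reflexive (linear-modular ω S T)
    }

  infixl 6 _⊕_
  _⊕_ : ∀ {n} → Rank n → Rank n → Rank n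
  f ⊕ g = record
    { rank            = λ S → rank f S + rank g S
    ; rank-monotone   = λ S T S⊆T →
        ℕ.+-mono-≤ (rank-monotone f S T S⊆T) (rank-monotone g S T S⊆T)
    ; rank-submodular = λ S T → subst₂ _≤_
        (interchange (rank f (S ∪ T)) (rank f (S ∩ T)) _ _) (interchange (rank f S) (rank f T) _ _)
        (ℕ.+-mono-≤ (rank-submodular f S T) (rank-submodular g S T))
    }

  ⨁ : ∀ {n K} → (Fin K → Rank n) → Rank n
  ⨁ {K = K} f = record
    { rank            = λ S → sum λ t → rank (f t) S
    ; rank-monotone   = λ S T S⊆T → sum-mono-≤ λ t → rank-monotone (f t) S T S⊆T
    ; rank-submodular = λ S T → subst₂ _≤_ (∑-distrib-+ {K} _ _) (∑-distrib-+ {K} _ _)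
        (sum-mono-≤ λ t → rank-submodular (f t) S T)
    }

  truncate : ∀ {n} → ℕ → Rank n → Rank n
  truncate c f = record
    { rank            = λ S → c ⊓ rank f S
    ; rank-monotone   = mono
    ; rank-submodular = submod
    }
    where
    mono : ∀ S T → S ⊆ T → c ⊓ rank f S ≤ c ⊓ rank f T
    mono S T S⊆T = ℕ.⊓-monoʳ-≤ c (rank-monotone f S T S⊆T)

    -- If one argument reaches the cap, the union is bounded by the cap and the intersection, by
    -- monotonicity, by the other argument. Otherwise the right-hand side is not truncated and
    -- submodularity of `f` suffices.
    submod : ∀ S T → c ⊓ rank f (S ∪ T) + c ⊓ rank f (S ∩ T) ≤ c ⊓ rank f S + c ⊓ rank f T
    submod S T with ℕ.≤-total c (rank f S) | ℕ.≤-total c (rank f T)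
    ... | inj₁ c≤fS | _ rewrite ℕ.m≤n⇒m⊓n≡m c≤fS =
      ℕ.+-mono-≤ (ℕ.m⊓n≤m c _) (mono (S ∩ T) T (p∩q⊆q S T))
    ... | inj₂ _ | inj₁ c≤fT rewrite ℕ.m≤n⇒m⊓n≡m c≤fT | ℕ.+-comm (c ⊓ rank f S) c =
      ℕ.+-mono-≤ (ℕ.m⊓n≤m c _) (mono (S ∩ T) S (p∩q⊆p S T))
    ... | inj₂ fS≤c | inj₂ fT≤c rewrite ℕ.m≥n⇒m⊓n≡n fS≤c | ℕ.m≥n⇒m⊓n≡n fT≤c =
      ℕ.≤-trans (ℕ.+-mono-≤ (ℕ.m⊓n≤n c _) (ℕ.m⊓n≤n c _)) (rank-submodular f S T)

-- Partial assignments as subcubes of the Boolean cube.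

module Covering where
  open SubmodularRanks using (sum)
  open import Data.Nat.Base using (_+_; _*_; _^_; _≤_; _<_)
  open import Algebra.Properties.CommutativeSemigroup ℕ.+-commutativeSemigroup using (interchange; x∙yz≈y∙xz)

  Partial : ℕ → Set
  Partial n = Fin n → Maybe Bool

  Consistent : ∀ {n} → Partial n → (Fin n → Bool) → Set
  Consistent T x = ∀ i β → T i ≡ just β → x i ≡ β

  defined : Maybe Bool → ℕ
  defined (just _) = 1
  defined nothing  = 0

  size : ∀ {n} → Partial n → ℕ
  size T = sum (defined ∘ T)

  choices : Maybe Bool → ℕ
  choices (just _) = 1
  choices nothing  = 2

  -- The number of points of the cube that extend `T`.
  volume : ∀ {n} → Partial n → ℕ
  volume {zero}  T = 1
  volume {suc n} T = choices (T zero) * volume (T ∘ suc)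

  -- Each coordinate contributes one factor 2: to the volume if it is free, to the power if it is
  -- defined.
  volume*2^size : ∀ {n} (T : Partial n) → volume T * 2 ^ size T ≡ 2 ^ n
  volume*2^size {zero}  T = refl
  volume*2^size {suc n} T with T zero
  ... | nothing = trans (ℕ.*-assoc 2 (volume (T ∘ suc)) _) (cong (2 *_) (volume*2^size (T ∘ suc)))
  ... | just _  = begin
    (1 * v) * (2 * s) ≡⟨ cong (_* (2 * s)) (ℕ.*-identityˡ v) ⟩
    v * (2 * s)       ≡⟨ ℕ.*-assoc v 2 s ⟨
    v * 2 * s         ≡⟨ cong (_* s) (ℕ.*-comm v 2) ⟩
    2 * v * s         ≡⟨ ℕ.*-assoc 2 v s ⟩
    2 * (v * s)       ≡⟨ cong (2 *_) (volume*2^size (T ∘ suc)) ⟩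
    2 * 2 ^ n         ∎
    where
    open ≡-Reasoning
    v = volume (T ∘ suc)
    s = 2 ^ size (T ∘ suc)

  allows : Maybe Bool → Bool → Bool
  allows nothing  b = true
  allows (just β) b = does (b Bool.≟ β)

  -- The trace of the list on the half cube with first bit `b`.
  slice : ∀ {n} → Bool → List (Partial (suc n)) → List (Partial n)
  slice b []      = []
  slice b (T ∷ L) = if allows (T zero) b then T ∘ suc ∷ slice b L else slice b L

  totalVolume : ∀ {n} → List (Partial n) → ℕ
  totalVolume []      = 0
  totalVolume (T ∷ L) = volume T + totalVolume L

  -- A free first bit puts `T ∘ suc` into both slices, matching the factor 2 in `volume T`; a fixed
  -- one puts it into a single slice.
  totalVolume-slice : ∀ {n} (L : List (Partial (suc n))) →
    totalVolume (slice true L) + totalVolume (slice false L) ≡ totalVolume L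
  totalVolume-slice []      = refl
  totalVolume-slice (T ∷ L) with T zero
  ... | nothing    = trans (interchange v _ v _)
    (cong₂ _+_ (cong (v +_) (sym (ℕ.+-identityʳ v))) (totalVolume-slice L))
    where v = volume (T ∘ suc)
  ... | just true  = trans (ℕ.+-assoc v _ _) (cong₂ _+_ (sym (ℕ.+-identityʳ v)) (totalVolume-slice L))
    where v = volume (T ∘ suc)
  ... | just false = trans (x∙yz≈y∙xz (totalVolume (slice true L)) v _)
    (cong₂ _+_ (sym (ℕ.+-identityʳ v)) (totalVolume-slice L))
    where v = volume (T ∘ suc)

  -- A `T` dropped from the slice already disagrees with `b`; a kept one is not consistent on the
  -- tail.
  avoids-slice : ∀ {n} b {x : Fin n → Bool} (L : List (Partial (suc n))) →
    All (λ T → ¬ Consistent T x) (slice b L) → All (λ T → ¬ Consistent T (b ∷ᶠ x)) L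
  avoids-slice b {x} []      av = []
  avoids-slice b {x} (T ∷ L) av with T zero in eq
  avoids-slice b {x} (T ∷ L) (¬c ∷ av) | nothing =
    (λ c → ¬c (c ∘ suc)) ∷ avoids-slice b L av
  avoids-slice b {x} (T ∷ L) av | just β with b Bool.≟ β
  avoids-slice b {x} (T ∷ L) (¬c ∷ av) | just β | yes _ =
    (λ c → ¬c (c ∘ suc)) ∷ avoids-slice b L av
  avoids-slice b {x} (T ∷ L) av | just β | no b≢β =
    (λ c → b≢β (c zero β eq)) ∷ avoids-slice b L av

  -- The method of conditional expectations: fix the bits of x one by one, each
  -- time keeping the half cube in which the partial assignments take up less room.
  uncovered : ∀ {n} (L : List (Partial n)) → totalVolume L < 2 ^ n →
    ∃ λ x → All (λ T → ¬ Consistent T x) L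
  uncovered {zero}  []      _        = (λ ()) , []
  -- On the zero-dimensional cube each partial assignment has volume 1, so the strict bound forces
  -- an empty list.
  uncovered {zero}  (T ∷ L) (s≤s ())
  uncovered {suc n} L       vol<
    with ℕ.<-≤-connex (totalVolume (slice true L)) (2 ^ n)
       | ℕ.<-≤-connex (totalVolume (slice false L)) (2 ^ n)
  ... | inj₁ small | _ =
    let x , av = uncovered (slice true L) small in true ∷ᶠ x , avoids-slice true L av
  ... | inj₂ _ | inj₁ small =
    let x , av = uncovered (slice false L) small in false ∷ᶠ x , avoids-slice false L av
  -- Two full halves would add up to a total volume of at least 2 ^ (n + 1).
  ... | inj₂ big₁ | inj₂ big₀ = contradiction
    (subst₂ _≤_ (cong (2 ^ n +_) (sym (ℕ.+-identityʳ (2 ^ n)))) (totalVolume-slice L)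
      (ℕ.+-mono-≤ big₁ big₀))
    (ℕ.<⇒≱ vol<)

  -- Size at least `t` means volume at most 2 ^ (n - t). Multiplying by `2 ^ t` avoids the
  -- subtraction and lets `volume*2^size` be summed over the list.
  totalVolume-large : ∀ {n} t (L : List (Partial n)) → All (λ T → t ≤ size T) L →
    totalVolume L * 2 ^ t ≤ length L * 2 ^ n
  totalVolume-large     t []      []          = z≤n
  totalVolume-large {n} t (T ∷ L) (t≤ ∷ all) = begin
    (volume T + totalVolume L) * 2 ^ t
      ≡⟨ ℕ.*-distribʳ-+ (2 ^ t) (volume T) _ ⟩
    volume T * 2 ^ t + totalVolume L * 2 ^ t
      ≤⟨ ℕ.+-mono-≤ (ℕ.*-monoʳ-≤ (volume T) (ℕ.^-monoʳ-≤ 2 t≤)) (totalVolume-large t L all) ⟩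
    volume T * 2 ^ size T + length L * 2 ^ n
      ≡⟨ cong (_+ length L * 2 ^ n) (volume*2^size T) ⟩
    2 ^ n + length L * 2 ^ n ∎
    where open ℕ.≤-Reasoning

  strings : ℕ → List (List Bool)
  strings zero    = [] ∷ []
  strings (suc C) = [] ∷ List.map (true ∷_) (strings C) List.++ List.map (false ∷_) (strings C)

  ∈-strings : ∀ C m → length m ≤ C → m ∈ᴸ strings C
  ∈-strings zero    []          _        = here refl
  ∈-strings (suc C) []          _        = here refl
  ∈-strings (suc C) (true  ∷ m) (s≤s l≤) = there (∈-++⁺ˡ (∈-map⁺ (true ∷_) (∈-strings C m l≤)))
  ∈-strings (suc C) (false ∷ m) (s≤s l≤) =
    there (∈-++⁺ʳ (List.map (true ∷_) (strings C)) (∈-map⁺ (false ∷_) (∈-strings C m l≤)))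

  -- The leading `suc` replaces the subtraction in 2 ^ (C + 1) - 1.
  length-strings : ∀ C → suc (length (strings C)) ≡ 2 ^ suc C
  length-strings zero    = refl
  length-strings (suc C) = begin
    suc (suc (length (List.map (true ∷_) L List.++ List.map (false ∷_) L)))
      ≡⟨ cong (2 +_) (List.length-++ (List.map (true ∷_) L)) ⟩
    suc (suc (length (List.map (true ∷_) L) + length (List.map (false ∷_) L)))
      ≡⟨ cong (2 +_) (cong₂ _+_ (List.length-map (true ∷_) L) (List.length-map (false ∷_) L)) ⟩
    suc (suc (length L + length L))
      ≡⟨ cong suc (ℕ.+-suc (length L) (length L)) ⟨
    suc (length L) + suc (length L)
      ≡⟨ cong (suc (length L) +_) (ℕ.+-identityʳ (suc (length L))) ⟨
    2 * suc (length L)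
      ≡⟨ cong (2 *_) (length-strings C) ⟩
    2 * 2 ^ suc C
      ∎
    where
    open ≡-Reasoning
    L = strings C

  -- There are fewer than 2 ^ (C + 1) strings of length at most C, and a partial
  -- assignment of size above C takes up at most the fraction 2 ^ -(C + 1) of the cube.
  small-consistent : ∀ {n} C (T : List Bool → Partial n) →
    ∃ λ x → ∀ m → length m ≤ C → Consistent (T m) x → size (T m) ≤ C
  small-consistent {n} C T = x , bounded
    where
    large? : ∀ (U : Partial n) → Dec (C < size U)
    large? U = C ℕ.<? size U

    large : List (Partial n)
    large = List.filter large? (List.map T (strings C))

    few : length large < 2 ^ suc C
    few = begin-strict
      length large                        ≤⟨ List.length-filter large? (List.map T (strings C)) ⟩
      length (List.map T (strings C))     ≡⟨ List.length-map T (strings C) ⟩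
      length (strings C)                  <⟨ ℕ.n<1+n _ ⟩
      suc (length (strings C))            ≡⟨ length-strings C ⟩
      2 ^ suc C                           ∎
      where open ℕ.≤-Reasoning

    vol< : totalVolume large < 2 ^ n
    vol< = ℕ.*-cancelʳ-< (2 ^ suc C) _ _ (begin-strict
      totalVolume large * 2 ^ suc C       ≤⟨ totalVolume-large (suc C) large (All.all-filter large? (List.map T (strings C))) ⟩
      length large * 2 ^ n                <⟨ ℕ.*-monoˡ-< (2 ^ n) {{ℕ.m^n≢0 2 n}} few ⟩
      2 ^ suc C * 2 ^ n                   ≡⟨ ℕ.*-comm (2 ^ suc C) _ ⟩
      2 ^ n * 2 ^ suc C                   ∎)
      where open ℕ.≤-Reasoning

    x : Fin n → Bool
    x = proj₁ (uncovered large vol<)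

    bounded : ∀ m → length m ≤ C → Consistent (T m) x → size (T m) ≤ C
    bounded m m≤C consistent = ℕ.≮⇒≥ λ C<size → All.lookup (proj₂ (uncovered large vol<))
      (∈-filter⁺ large? (∈-map⁺ T (∈-strings C m m≤C)) C<size) consistent

-- Choice under double negation over finite index sets.

module Choice where
  open import Data.Nat.Base using (_≤_)

  -- The goal is a negation, so finitely many witnesses can be extracted one after another.
  ¬¬-choice-Fin : ∀ {n a q} {A : Set a} {Q : Fin n → A → Set q} →
    (∀ i → ¬ ¬ ∃ (Q i)) → ¬ ¬ ∃ λ (F : Fin n → A) → ∀ i → Q i (F i)
  ¬¬-choice-Fin {zero}  h ¬F = ¬F ((λ ()) , λ ())
  ¬¬-choice-Fin {suc n} h ¬F = h zero λ (y , q) → ¬¬-choice-Fin (h ∘ suc) λ (F , r) →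
    ¬F (y ∷ᶠ F , λ { zero → q ; (suc i) → r i })

  -- There are finitely many strings of length at most `C`; on longer ones `F` takes a default value
  -- from the base case.
  ¬¬-choice-strings : ∀ {a q} {A : Set a} C {Q : List Bool → A → Set q} →
    (∀ m → ¬ ¬ ∃ (Q m)) → ¬ ¬ ∃ λ (F : List Bool → A) → ∀ m → length m ≤ C → Q m (F m)
  ¬¬-choice-strings zero    h ¬F = h [] λ (y , q) → ¬F (const y , λ { [] _ → q })
  ¬¬-choice-strings (suc C) h ¬F =
    h [] λ (y , q) →
    ¬¬-choice-strings C (h ∘ (true ∷_)) λ (F₁ , r₁) →
    ¬¬-choice-strings C (h ∘ (false ∷_)) λ (F₀ , r₀) →
    ¬F ( (λ { [] → y ; (true ∷ m) → F₁ m ; (false ∷ m) → F₀ m })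
       , λ { [] _ → q ; (true ∷ m) (s≤s l) → r₁ m l ; (false ∷ m) (s≤s l) → r₀ m l })

-- The hard functions, one for each hidden group.

module HardInstance
  (a n K : ℕ) (group : Fin a → Fin n × Bool) (layer : Fin a → Fin K)
  (element : Fin n × Bool → Fin K → Fin a)
  (group-element : ∀ q t → group (element q t) ≡ q)
  (layer-element : ∀ q t → layer (element q t) ≡ t)
  where

  open SubmodularRanks
  open import Data.Nat.Base using (_+_; _*_; _⊓_; _≤_)

  Group : Set
  Group = Fin n × Bool

  infix 4 _≟ᴳ_
  _≟ᴳ_ : (q r : Group) → Dec (q ≡ r)
  _≟ᴳ_ = Product.≡-dec Fin._≟_ Bool._≟_

  inLayer : Fin K → Fin a → Bool
  inLayer t p = does (layer p Fin.≟ t)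

  own other : Group → Fin K → Fin a → ℕ
  own   q t p = indicator (inLayer t p ∧ does (group p ≟ᴳ q))
  other q t p = indicator (inLayer t p ∧ not (does (group p ≟ᴳ q)))

  -- The rank function of an arrangement in the projective plane: the elements of
  -- the layer are generic lines, Bob's element is a point, and the lines passing
  -- through that point are exactly those outside the group q.
  layerRank : Group → Fin K → Rank (a + 1)
  layerRank q t = truncate 3
    (truncate 1 (modular (tabulate (other q t) ++ 1 ∷ []))
      ⊕ modular (tabulate (other q t) ++ 0 ∷ [])
      ⊕ modular (tabulate (own q t) ++ 0 ∷ [])
      ⊕ modular (tabulate (own q t) ++ 0 ∷ []))

  hard : Group → Rank (a + 1)
  hard q = ⨁ (layerRank q)

  hard≤ : ∀ q S → rank (hard q) S ≤ K * 3
  hard≤ q S = ℕ.≤-trans (sum-mono-≤ {K} λ t → ℕ.m⊓n≤m 3 _) (ℕ.≤-reflexive (sum-const K 3))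

  private
    -- Here `j` lines pass through the point and `i` avoid it. For j ≤ 1 the terms `1 ⊓ j + j` are
    -- 2j; for larger `j` both sides reach the cap 3.
    lineRank : ∀ j i → 3 ⊓ (1 ⊓ j + j + i + i) ≡ 3 ⊓ (2 * (j + i))
    lineRank 0 i = cong (3 ⊓_) (cong (i +_) (sym (ℕ.+-identityʳ i)))
    lineRank 1 i = cong (λ r → 3 ⊓ suc r)
      (trans (cong suc (cong (i +_) (sym (ℕ.+-identityʳ i)))) (sym (ℕ.+-suc i (i + 0))))
    lineRank (suc (suc j)) i = cong (λ r → 3 ⊓ suc (suc r)) (sym (ℕ.+-suc (j + i) (suc (j + i + 0))))

    linear-++0 : ∀ (g : Fin a → ℕ) A (B : Subset 1) →
      linear (tabulate g ++ 0 ∷ []) (A ++ B) ≡ linear (tabulate g) A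
    linear-++0 g A (inside  ∷ []) = trans (linear-++ (tabulate g) (0 ∷ []) A (inside ∷ []))  (ℕ.+-identityʳ _)
    linear-++0 g A (outside ∷ []) = trans (linear-++ (tabulate g) (0 ∷ []) A (outside ∷ [])) (ℕ.+-identityʳ _)

    split-layer : ∀ u v → indicator (u ∧ not v) + indicator (u ∧ v) ≡ indicator u
    split-layer false _     = refl
    split-layer true  false = refl
    split-layer true  true  = refl

    layer-count : ∀ q t A →
      linear (tabulate (other q t)) A + linear (tabulate (own q t)) A ≡
      linear (tabulate (indicator ∘ inLayer t)) A
    layer-count q t A = trans (sym (linear-tabulate-+ (other q t) (own q t) A))
      (linear-tabulate-cong (λ p → split-layer (inLayer t p) (does (group p ≟ᴳ q))) A)

  layerRank-Alice : ∀ q t A →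
    rank (layerRank q t) (A ++ ⊥) ≡ 3 ⊓ (2 * linear (tabulate (indicator ∘ inLayer t)) A)
  layerRank-Alice q t A = begin
    rank (layerRank q t) (A ++ ⊥)
      ≡⟨ cong₂ (λ h i → 3 ⊓ (1 ⊓ h + linear (tabulate (other q t) ++ 0 ∷ []) (A ++ ⊥) + i + i))
           (trans (linear-++ (tabulate (other q t)) (1 ∷ []) A ⊥) (ℕ.+-identityʳ _))
           (linear-++0 (own q t) A ⊥) ⟩
    3 ⊓ (1 ⊓ j + linear (tabulate (other q t) ++ 0 ∷ []) (A ++ ⊥) + i + i)
      ≡⟨ cong (λ h → 3 ⊓ (1 ⊓ j + h + i + i)) (linear-++0 (other q t) A ⊥) ⟩
    3 ⊓ (1 ⊓ j + j + i + i)
      ≡⟨ lineRank j i ⟩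
    3 ⊓ (2 * (j + i))
      ≡⟨ cong (λ l → 3 ⊓ (2 * l)) (layer-count q t A) ⟩
    3 ⊓ (2 * linear (tabulate (indicator ∘ inLayer t)) A) ∎
    where
    open ≡-Reasoning
    j = linear (tabulate (other q t)) A
    i = linear (tabulate (own q t)) A

  -- The group has disappeared from the right-hand side of `layerRank-Alice`, so Alice's oracle
  -- cannot tell groups apart.
  hard-Alice : ∀ q r A → rank (hard q) (A ++ ⊥) ≡ rank (hard r) (A ++ ⊥)
  hard-Alice q r A = sum-cong-≗ {K} λ t → trans (layerRank-Alice q t A) (sym (layerRank-Alice r t A))

  Hits : Group → Subset (a + 1) → Set
  Hits q S = ∃ λ p → group p ≡ q × p ↑ˡ 1 ∈ S

  private
    own≡0 : ∀ q t p → group p ≢ q → own q t p ≡ 0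
    own≡0 q t p p∉q rewrite dec-false (group p ≟ᴳ q) p∉q = cong indicator (Bool.∧-zeroʳ (inLayer t p))

  -- Without lines of `q`, a layer is worth at most 1 for the point and 1 for each of its lines. For
  -- sets of size at most K + 1 this gives 2K + 1.
  hard-miss : ∀ q S → ¬ Hits q S → rank (hard q) S ≤ K + ∣ S ∣
  hard-miss q S miss with splitAt a S
  ... | A , B , refl = begin
    rank (hard q) (A ++ B)
      ≤⟨ sum-mono-≤ layer≤ ⟩
    sum (λ t → 1 + linear (tabulate (indicator ∘ inLayer t)) A)
      ≡⟨ ∑-distrib-+ {K} (const 1) _ ⟩
    sum {K} (const 1) + sum (λ t → linear (tabulate (indicator ∘ inLayer t)) A)
      ≡⟨ cong₂ _+_ (trans (sum-const K 1) (ℕ.*-identityʳ K)) (sum-linear-classes layer A) ⟩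
    K + ∣ A ∣
      ≤⟨ ℕ.+-monoʳ-≤ K (ℕ.≤-trans (ℕ.m≤m+n _ _) (ℕ.≤-reflexive (sym (∣++∣ A B)))) ⟩
    K + ∣ A ++ B ∣ ∎
    where
    open ℕ.≤-Reasoning

    own-A≡0 : ∀ t → linear (tabulate (own q t)) A ≡ 0
    own-A≡0 t = linear≡0 (tabulate (own q t)) A λ p p∈A →
      trans (lookup∘tabulate (own q t) p) (own≡0 q t p λ p∈q → miss (p , p∈q ,
        lookup⇒[]= (p ↑ˡ 1) (A ++ B) (trans (lookup-++ˡ A B p) ([]=⇒lookup p∈A))))

    layer≤ : ∀ t → rank (layerRank q t) (A ++ B) ≤ 1 + linear (tabulate (indicator ∘ inLayer t)) A
    layer≤ t = begin
      rank (layerRank q t) (A ++ B)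
        ≤⟨ ℕ.m⊓n≤n 3 _ ⟩
      1 ⊓ linear (tabulate (other q t) ++ 1 ∷ []) (A ++ B)
        + linear (tabulate (other q t) ++ 0 ∷ []) (A ++ B) + i + i
        ≤⟨ ℕ.+-monoˡ-≤ i (ℕ.+-monoˡ-≤ i (ℕ.+-mono-≤ (ℕ.m⊓n≤m 1 _) (ℕ.≤-reflexive (linear-++0 (other q t) A B)))) ⟩
      1 + j + i + i
        ≡⟨ cong (λ i → 1 + j + i + i) i≡0 ⟩
      1 + j + 0 + 0
        ≡⟨ trans (ℕ.+-identityʳ _) (ℕ.+-identityʳ _) ⟩
      1 + j
        ≤⟨ ℕ.+-monoʳ-≤ 1 (ℕ.m≤m+n j _) ⟩
      1 + (j + linear (tabulate (own q t)) A)
        ≡⟨ cong (1 +_) (layer-count q t A) ⟩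
      1 + linear (tabulate (indicator ∘ inLayer t)) A ∎
      where
      j = linear (tabulate (other q t)) A
      i = linear (tabulate (own q t) ++ 0 ∷ []) (A ++ B)
      i≡0 : i ≡ 0
      i≡0 = trans (linear-++0 (own q t) A B) (own-A≡0 t)

  best : Group → Subset (a + 1)
  best q = image (element q) ++ ⊤

  ∣best∣ : ∀ q → ∣ best q ∣ ≤ suc K
  ∣best∣ q = begin
    ∣ best q ∣                ≡⟨ ∣++∣ (image (element q)) ⊤ ⟩
    ∣ image (element q) ∣ + 1 ≤⟨ ℕ.+-monoˡ-≤ 1 (∣image∣ (element q)) ⟩
    K + 1                     ≡⟨ ℕ.+-comm K 1 ⟩
    suc K                     ∎
    where open ℕ.≤-Reasoning

  -- Every layer reaches its cap: the point contributes 1 and the line of `q`, which avoids it,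
  -- contributes 2.
  hard-best : ∀ q → rank (hard q) (best q) ≡ K * 3
  hard-best q = ℕ.≤-antisym (hard≤ q (best q))
    (ℕ.≤-trans (ℕ.≤-reflexive (sym (sum-const K 3))) (sum-mono-≤ layer≥))
    where
    own≡1 : ∀ t → own q t (element q t) ≡ 1
    own≡1 t rewrite dec-true (layer (element q t) Fin.≟ t) (layer-element q t)
                  | dec-true (group (element q t) ≟ᴳ q) (group-element q t) = refl

    own≥1 : ∀ t → 1 ≤ linear (tabulate (own q t) ++ 0 ∷ []) (best q)
    own≥1 t = begin
      1                                                   ≡⟨ own≡1 t ⟨
      own q t (element q t)                               ≡⟨ lookup∘tabulate (own q t) _ ⟨
      lookup (tabulate (own q t)) (element q t)           ≤⟨ lookup≤linear (tabulate (own q t)) (∈-image (element q) t) ⟩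
      linear (tabulate (own q t)) (image (element q))     ≡⟨ linear-++0 (own q t) _ ⊤ ⟨
      linear (tabulate (own q t) ++ 0 ∷ []) (best q)      ∎
      where open ℕ.≤-Reasoning

    point≥1 : ∀ t → 1 ≤ linear (tabulate (other q t) ++ 1 ∷ []) (best q)
    point≥1 t = ℕ.≤-trans (ℕ.m≤n+m 1 _)
      (ℕ.≤-reflexive (sym (linear-++ (tabulate (other q t)) (1 ∷ []) (image (element q)) ⊤)))

    layer≥ : ∀ t → 3 ≤ rank (layerRank q t) (best q)
    layer≥ t = ℕ.⊓-glb ℕ.≤-refl
      (ℕ.+-mono-≤ (ℕ.+-mono-≤ (ℕ.≤-trans (ℕ.⊓-glb ℕ.≤-refl (point≥1 t)) (ℕ.m≤m+n _ _)) (own≥1 t)) (own≥1 t))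

  chosen : (Fin n → Bool) → Subset a
  chosen x = tabulate λ p → does (x (proj₁ (group p)) Bool.≟ proj₂ (group p))

  ∈-chosen : ∀ x p → x (proj₁ (group p)) ≡ proj₂ (group p) → p ∈ chosen x
  ∈-chosen x p eq = lookup⇒[]= p (chosen x) (trans (lookup∘tabulate _ p) (dec-true (_ Bool.≟ _) eq))

  chosen⁻ : ∀ x p → p ∈ chosen x → x (proj₁ (group p)) ≡ proj₂ (group p)
  chosen⁻ x p p∈ with x (proj₁ (group p)) Bool.≟ proj₂ (group p)
                    | trans (sym (lookup∘tabulate _ p)) ([]=⇒lookup p∈)
  ... | yes eq | _ = eq
  ... | no  _  | ()

  best⊆ : ∀ x i → best (i , x i) ⊆ chosen x ++ ⊤
  best⊆ x i = ++-mono-⊆ λ p∈ → case image⁻ (element (i , x i)) p∈ of λ where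
    (t , refl) → ∈-chosen x _ (subst (λ r → x (proj₁ r) ≡ proj₂ r) (sym (group-element (i , x i) t)) refl)

  -- This is how an answer leaks a bit of `x`: whatever it contains on Alice's side lies in a group
  -- selected by `x`.
  Hits-chosen : ∀ x q S → S ⊆ chosen x ++ ⊤ → Hits q S → x (proj₁ q) ≡ proj₂ q
  Hits-chosen x q S S⊆ (p , refl , p∈S) = chosen⁻ x p (lookup⇒[]= p (chosen x)
    (trans (sym (lookup-++ˡ (chosen x) ⊤ p)) ([]=⇒lookup (S⊆ p∈S))))

-- Constructive arithmetic in ordered fields.

module OrderedFieldProperties {c ℓ} (F : OrderedField c ℓ) where
  open OrderedField F hiding (zero)
  open import Algebra.Properties.Semiring.Mult semiring using (×-homo-+; ×1-homo-*)
  open import Algebra.Properties.Semiring.Sum semiring public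
    using (sum; sum-cong-≋; *-distribˡ-sum; *-distribʳ-sum; ∑-comm)

  ≤-reflexive : ∀ {x y} → x ≈ y → x ≤ y
  ≤-reflexive x≈y = <-irrefl (≈-sym x≈y)

  ≤-trans : ∀ {x y z} → x ≤ y → y ≤ z → x ≤ z
  ≤-trans {y = y} x≤y y≤z z<x with <-cotransitive z<x y
  ... | inj₁ z<y = y≤z z<y
  ... | inj₂ y<x = x≤y y<x

  ≤-preorder : Preorder c ℓ ℓ
  ≤-preorder = record
    { isPreorder = record
      { isEquivalence = isEquivalence
      ; reflexive     = ≤-reflexive
      ; trans         = ≤-trans
      }
    }

  module ≤-Reasoning = PreorderReasoning ≤-preorder

  <⇒≤ : ∀ {x y} → x < y → x ≤ y
  <⇒≤ x<y y<x = <-asym x<y y<x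

  <-≤-trans : ∀ {x y z} → x < y → y ≤ z → x < z
  <-≤-trans {z = z} x<y y≤z with <-cotransitive x<y z
  ... | inj₁ x<z = x<z
  ... | inj₂ z<y = contradiction z<y y≤z

  x+y-y≈x : ∀ x y → (x + y) - y ≈ x
  x+y-y≈x x y = ≈-trans (+-assoc x y (- y)) (≈-trans (+-congˡ (-‿inverseʳ y)) (+-identityʳ x))

  x+[y-x]≈y : ∀ x y → x + (y - x) ≈ y
  x+[y-x]≈y x y = ≈-trans (≈-sym (+-assoc x y (- x))) (≈-trans (+-congʳ (+-comm x y)) (x+y-y≈x y x))

  +-monoˡ-≤ : ∀ {x y} z → x ≤ y → x + z ≤ y + z
  +-monoˡ-≤ {x} {y} z x≤y lt =
    x≤y (<-respˡ-≈ (x+y-y≈x y z) (<-respʳ-≈ (x+y-y≈x x z) (+-monoˡ-< (- z) lt)))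

  +-monoʳ-≤ : ∀ {x y} z → x ≤ y → z + x ≤ z + y
  +-monoʳ-≤ {x} {y} z x≤y =
    ≤-trans (≤-reflexive (+-comm z x)) (≤-trans (+-monoˡ-≤ z x≤y) (≤-reflexive (+-comm y z)))

  +-mono-≤ : ∀ {x y u v} → x ≤ y → u ≤ v → x + u ≤ y + v
  +-mono-≤ {y = y} {u} x≤y u≤v = ≤-trans (+-monoˡ-≤ u x≤y) (+-monoʳ-≤ y u≤v)

  +-cancelʳ-≤ : ∀ {x y} z → x + z ≤ y + z → x ≤ y
  +-cancelʳ-≤ z le y<x = le (+-monoˡ-< z y<x)

  x≤x+y : ∀ x {y} → 0# ≤ y → x ≤ x + y
  x≤x+y x 0≤y = ≤-trans (≤-reflexive (≈-sym (+-identityʳ x))) (+-monoʳ-≤ x 0≤y)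

  -- The goal is a negation, so each factor may be taken as positive or not; a non-negative factor
  -- that is not positive is zero by tightness.
  *-nonNeg : ∀ {x y} → 0# ≤ x → 0# ≤ y → 0# ≤ x * y
  *-nonNeg {x} {y} 0≤x 0≤y xy<0 = ¬0<x λ 0<x → ¬0<y λ 0<y → <-asym (*-pos 0<x 0<y) xy<0
    where
    ¬0<x : ¬ ¬ (0# < x)
    ¬0<x x≯0 = <-irrefl ≈-refl (<-respˡ-≈ (≈-trans (*-congʳ (≈-sym (<-tight x≯0 0≤x))) (zeroˡ y)) xy<0)
    ¬0<y : ¬ ¬ (0# < y)
    ¬0<y y≯0 = <-irrefl ≈-refl (<-respˡ-≈ (≈-trans (*-congˡ (≈-sym (<-tight y≯0 0≤y))) (zeroʳ x)) xy<0)

  0≤y-x : ∀ {x y} → x ≤ y → 0# ≤ y - x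
  0≤y-x {x} x≤y = ≤-trans (≤-reflexive (≈-sym (-‿inverseʳ x))) (+-monoˡ-≤ (- x) x≤y)

  *-monoˡ-≤ : ∀ {x y z} → 0# ≤ z → x ≤ y → x * z ≤ y * z
  *-monoˡ-≤ {x} {y} {z} 0≤z x≤y = begin
    x * z                 ≲⟨ x≤x+y (x * z) (*-nonNeg (0≤y-x x≤y) 0≤z) ⟩
    x * z + (y - x) * z   ≈⟨ distribʳ z x (y - x) ⟨
    (x + (y - x)) * z     ≈⟨ *-congʳ (x+[y-x]≈y x y) ⟩
    y * z                 ∎
    where open ≤-Reasoning

  *-monoʳ-≤ : ∀ {x y z} → 0# ≤ z → x ≤ y → z * x ≤ z * y
  *-monoʳ-≤ {x} {y} {z} 0≤z x≤y =
    ≤-trans (≤-reflexive (*-comm z x)) (≤-trans (*-monoˡ-≤ 0≤z x≤y) (≤-reflexive (*-comm y z)))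

  *-cancelʳ-≤ : ∀ {x y z} → 0# < z → x * z ≤ y * z → x ≤ y
  *-cancelʳ-≤ {x} {y} {z} 0<z xz≤yz y<x = xz≤yz (<-respˡ-≈ (+-identityˡ (y * z))
    (<-respʳ-≈ eq (+-monoˡ-< (y * z) (*-pos 0<x-y 0<z))))
    where
    0<x-y : 0# < x - y
    0<x-y = <-respˡ-≈ (-‿inverseʳ y) (+-monoˡ-< (- y) y<x)
    eq : (x - y) * z + y * z ≈ x * z
    eq = ≈-trans (≈-sym (distribʳ z (x - y) y)) (*-congʳ (≈-trans (+-comm (x - y) y) (x+[y-x]≈y y x)))

  fromℕ-nonNeg : ∀ n → 0# ≤ fromℕ n
  fromℕ-nonNeg zero    = ≤-reflexive ≈-refl
  fromℕ-nonNeg (suc n) = <⇒≤ (fromℕ-pos n)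

  fromℕ-mono-≤ : ∀ {m n} → m ℕ.≤ n → fromℕ m ≤ fromℕ n
  fromℕ-mono-≤ {n = n} z≤n = fromℕ-nonNeg n
  fromℕ-mono-≤ (s≤s m≤n)   = +-monoʳ-≤ 1# (fromℕ-mono-≤ m≤n)

  fromℕ-+ : ∀ m n → fromℕ (m ℕ.+ n) ≈ fromℕ m + fromℕ n
  fromℕ-+ = ×-homo-+ 1#

  fromℕ-* : ∀ m n → fromℕ (m ℕ.* n) ≈ fromℕ m * fromℕ n
  fromℕ-* = ×1-homo-*

  fromℕ-sum : ∀ {n} (g : Fin n → ℕ) → sum (fromℕ ∘ g) ≈ fromℕ (SubmodularRanks.sum g)
  fromℕ-sum {zero}  g = ≈-refl
  fromℕ-sum {suc n} g = ≈-trans (+-congˡ (fromℕ-sum (g ∘ suc))) (≈-sym (fromℕ-+ (g zero) _))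

  sum-const : ∀ n x → sum {n} (const x) ≈ fromℕ n * x
  sum-const zero    x = ≈-sym (zeroˡ x)
  sum-const (suc n) x = ≈-trans (+-cong (≈-sym (*-identityˡ x)) (sum-const n x)) (≈-sym (distribʳ x 1# (fromℕ n)))

  sum-mono-≤ : ∀ {n} {g h : Fin n → Carrier} → (∀ i → g i ≤ h i) → sum g ≤ sum h
  sum-mono-≤ {zero}  g≤h = ≤-reflexive ≈-refl
  sum-mono-≤ {suc n} g≤h = +-mono-≤ (g≤h zero) (sum-mono-≤ (g≤h ∘ suc))

  sum-nonNeg : ∀ {n} (g : Fin n → Carrier) → (∀ i → 0# ≤ g i) → 0# ≤ sum g
  sum-nonNeg {zero}  g 0≤g = ≤-reflexive ≈-refl
  sum-nonNeg {suc n} g 0≤g = ≤-trans (0≤g zero) (x≤x+y (g zero) (sum-nonNeg (g ∘ suc) (0≤g ∘ suc)))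

  term≤sum : ∀ {n} (g : Fin n → Carrier) → (∀ i → 0# ≤ g i) → ∀ i → g i ≤ sum g
  term≤sum g 0≤g zero    = x≤x+y (g zero) (sum-nonNeg (g ∘ suc) (0≤g ∘ suc))
  term≤sum g 0≤g (suc i) = ≤-trans (term≤sum (g ∘ suc) (0≤g ∘ suc) i)
    (≤-trans (x≤x+y _ (0≤g zero)) (≤-reflexive (+-comm _ (g zero))))

  /ℕ-cancel : ∀ x n .{{_ : NonZero n}} → (x /ℕ n) * fromℕ n ≈ x
  /ℕ-cancel x n@(suc n-1) = begin
    x * inv (fromℕ n) (fromℕ-pos n-1) * fromℕ n   ≈⟨ *-assoc x _ _ ⟩
    x * (inv (fromℕ n) (fromℕ-pos n-1) * fromℕ n) ≈⟨ *-congˡ (*-comm _ (fromℕ n)) ⟩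
    x * (fromℕ n * inv (fromℕ n) (fromℕ-pos n-1)) ≈⟨ *-congˡ (*-inverseʳ (fromℕ n) (fromℕ-pos n-1)) ⟩
    x * 1#                                        ≈⟨ *-identityʳ x ⟩
    x                                             ∎
    where open SetoidReasoning setoid

  -- Cotransitivity applied to 0 < x + n x at the point x yields 0 < x or 0 < n x. This serves for
  -- the positivity of quotients.
  fromℕ*-pos⁻ : ∀ n {x} → 0# < fromℕ n * x → 0# < x
  fromℕ*-pos⁻ zero    {x} 0<0x = contradiction 0<0x (≤-reflexive (zeroˡ x))
  fromℕ*-pos⁻ (suc n) {x} 0<
    with <-cotransitive (<-respʳ-≈ (≈-trans (distribʳ x 1# (fromℕ n)) (+-congʳ (*-identityˡ x))) 0<) x
  ... | inj₁ 0<x   = 0<x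
  ... | inj₂ x<x+y = fromℕ*-pos⁻ n (<-respˡ-≈ (-‿inverseʳ x) (<-respʳ-≈
    (≈-trans (+-congʳ (+-comm x (fromℕ n * x))) (x+y-y≈x (fromℕ n * x) x)) (+-monoˡ-< (- x) x<x+y)))

  /ℕ-pos : ∀ {x} → 0# < x → ∀ n .{{_ : NonZero n}} → 0# < x /ℕ n
  /ℕ-pos {x} 0<x n = fromℕ*-pos⁻ n (<-respʳ-≈ (≈-trans (≈-sym (/ℕ-cancel x n)) (*-comm _ (fromℕ n))) 0<x)

-- Randomised protocols on the hard instances.

module TwoPlayerProperties {c ℓ} (ℝ : RealNumbers c ℓ) where
  open RealNumbers ℝ hiding (zero)
  open TwoPlayer ℝ
  open OrderedFieldProperties orderedField
  open SubmodularRanks using (Rank; rank; rank-monotone; rank-submodular)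
  open Covering using (Partial; Consistent; defined; small-consistent) renaming (size to sizeᵖ)
  open Choice

  module _ {a} {A : Set a} where

    -- A comparison on possible outcomes suffices: a probability that is not positive is zero by
    -- tightness, and both terms vanish.
    𝔼-mono : ∀ (d : Random A) {X Y : A → Carrier} →
      (∀ y → Possible d y → X y ≤ Y y) → 𝔼 d X ≤ 𝔼 d Y
    𝔼-mono d {X} {Y} X≤Y = sum-mono-≤ term
      where
      term : ∀ i → prob d i * X (outcome d i) ≤ prob d i * Y (outcome d i)
      term i lt = <-irrefl ≈-refl (<-respˡ-≈ (vanishes Y) (<-respʳ-≈ (vanishes X) lt))
        where
        p≯0 : ¬ (0# < prob d i)
        p≯0 0<p = *-monoʳ-≤ (<⇒≤ 0<p) (X≤Y (outcome d i) (i , 0<p , refl)) lt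
        vanishes : ∀ Z → prob d i * Z (outcome d i) ≈ 0#
        vanishes Z = ≈-trans (*-congʳ (≈-sym (<-tight p≯0 (prob-nonNeg d i)))) (zeroˡ _)

    𝔼-const : ∀ (d : Random A) B → 𝔼 d (const B) ≈ B
    𝔼-const d B = ≈-trans (≈-sym (*-distribʳ-sum B (prob d))) (≈-trans (*-congʳ (prob-total d)) (*-identityˡ B))

    𝔼-≤ : ∀ (d : Random A) {X B} → (∀ y → Possible d y → X y ≤ B) → 𝔼 d X ≤ B
    𝔼-≤ d {B = B} X≤B = ≤-trans (𝔼-mono d X≤B) (≤-reflexive (𝔼-const d B))

    sum-𝔼 : ∀ {n} (d : Random A) (X : Fin n → A → Carrier) →
      sum (λ i → 𝔼 d (X i)) ≈ 𝔼 d (λ y → sum λ i → X i y)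
    sum-𝔼 d X = ≈-trans (∑-comm (λ i j → prob d j * X i (outcome d j)))
      (sum-cong-≋ λ j → ≈-sym (*-distribˡ-sum (prob d j) (λ i → X i (outcome d j))))

    -- With no possible outcome, the expectation of the constant 1 would be at most 0.
    possible : ∀ (d : Random A) → ¬ ¬ ∃ (Possible d)
    possible d none = 𝔼-≤ d {const 1#} {0#} (λ y p → contradiction (y , p) none)
      (<-respʳ-≈ (≈-sym (𝔼-const d 1#)) 0<1)

    -- The indicator of `y` has positive expectation under `d`, but expectation at most 0 under `e`
    -- if `y` is impossible there.
    sameLaw-possible : DecidableEquality A → ∀ (d e : Random A) → SameLaw d e →
      ∀ {y} → Possible d y → ¬ ¬ Possible e y
    sameLaw-possible _≟_ d e same {y} (i , 0<p , refl) impossible =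
      𝔼-≤ e {at} {0#} never (<-respʳ-≈ (same at) 0<at)
      where
      at : A → Carrier
      at z = if does (z ≟ y) then 1# else 0#

      at-nonNeg : ∀ z → 0# ≤ at z
      at-nonNeg z with does (z ≟ y)
      ... | true  = <⇒≤ 0<1
      ... | false = ≤-reflexive ≈-refl

      never : ∀ z → Possible e z → at z ≤ 0#
      never z pz with z ≟ y
      ... | yes refl = contradiction pz impossible
      ... | no  _    = ≤-reflexive ≈-refl

      at-y : at y ≈ 1#
      at-y rewrite dec-true (y ≟ y) refl = ≈-refl

      0<at : 0# < 𝔼 d at
      0<at = <-≤-trans
        (<-respʳ-≈ (≈-sym (≈-trans (*-congˡ at-y) (*-identityʳ (prob d i)))) 0<p)
        (term≤sum _ (λ j → *-nonNeg (prob-nonNeg d j) (at-nonNeg (outcome d j))) i)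

  realize : ∀ {n} → Rank n → SubmodularFunction n
  realize f = record
    { value       = λ S → fromℕ (rank f S)
    ; nonNegative = λ S → fromℕ-nonNeg (rank f S)
    ; monotone    = λ S T S⊆T → fromℕ-mono-≤ (rank-monotone f S T S⊆T)
    ; submodular  = λ S T → ≤-trans (≤-reflexive (≈-sym (fromℕ-+ (rank f (S ∪ T)) _)))
        (≤-trans (fromℕ-mono-≤ (rank-submodular f S T)) (≤-reflexive (fromℕ-+ (rank f S) _)))
    }

  -- Adding up the guarantee over the groups that Alice owns.

  module _ (K : ℕ) (P : Protocol (suc K)) (ρ : Carrier) (approx : ApproximationGuarantee P ρ)
    (N C : ℕ) (communication : CommunicationAtMost P N C)
    (a n : ℕ) (a+1≡N : a ℕ.+ 1 ≡ N)
    (group : Fin a → Fin n × Bool) (layer : Fin a → Fin K)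
    (element : Fin n × Bool → Fin K → Fin a)
    (group-element : ∀ q t → group (element q t) ≡ q)
    (layer-element : ∀ q t → layer (element q t) ≡ t)
    (q₀ : Fin n × Bool)
    where

    open HardInstance a n K group layer element group-element layer-element

    private
      f : Group → SubmodularFunction (a ℕ.+ 1)
      f q = realize (hard q)

      message : (Fin n → Bool) → Group → Random Message
      message x q = alice P a 1 (chosen x) (restrictᴬ a 1 (f q))

      answer : Message → Group → Random (Subset (a ℕ.+ 1))
      answer m q = bob P a 1 ⊤ m (f q)

      MayHit : Message → Group → Set ℓ
      MayHit m q = ∃ λ S → Possible (answer m q) S × Hits q S

      -- The condition on the entry of the partial assignment at `i`. If both groups of the pair may
      -- be hit, either bit qualifies.
      Knows : Message → Fin n → Maybe Bool → Set ℓ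
      Knows m i (just β) = MayHit m (i , β)
      Knows m i nothing  = ∀ β → ¬ MayHit m (i , β)

      -- If no bit qualifies, neither group may be hit, and then `nothing` does.
      ¬¬knows : ∀ m i → ¬ ¬ ∃ (Knows m i)
      ¬¬knows m i ¬k = ¬k (nothing , λ β hit → ¬k (just β , hit))

      -- This allows all groups to be compared under the single message law of `q₀`.
      sameMessage : ∀ x q r → SameLaw (message x q) (message x r)
      sameMessage x q r = alice-oracle P a 1 (chosen x) λ S → reflexive (cong fromℕ (hard-Alice q r S))

      module _ (T : Message → Partial n) (knows : ∀ m → length m ℕ.≤ C → ∀ i → Knows m i (T m i)) where

        x : Fin n → Bool
        x = proj₁ (small-consistent C T)

        short : ∀ q m → Possible (message x q) m → length m ℕ.≤ C
        short q = communication a 1 a+1≡N (chosen x) (f q)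

        -- The message is also possible when `(i , β)` is the special group, and Bob may then hit
        -- that group. Feasibility puts the element hit into Alice's set, whence `x i` is `β`.
        consistent : ∀ m → Possible (message x q₀) m → Consistent (T m) x
        consistent m m? i β Tmi≡β = decidable-stable (x i Bool.≟ β) λ xi≢β →
          sameLaw-possible (List.≡-dec Bool._≟_) (message x q₀) (message x (i , β))
            (sameMessage x q₀ (i , β)) m? λ m?′ →
          let S , S? , hit = subst (Knows m i) Tmi≡β (knows m (short q₀ m m?) i)
          in xi≢β (Hits-chosen x (i , β) S (proj₁ (feasible P a 1 (chosen x) ⊤ (f (i , β)) m S m?′ S?)) hit)

        few : ∀ m → Possible (message x q₀) m → sizeᵖ (T m) ℕ.≤ C
        few m m? = proj₂ (small-consistent C T) m (short q₀ m m?) (consistent m m?)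

        -- A defined entry gives 3K + 1, one above the cap, so that both cases share one formula
        -- linear in `defined`.
        bound : Fin n → Message → ℕ
        bound i m = K ℕ.+ suc K ℕ.+ defined (T m i) ℕ.* K

        -- A defined entry is charged the full cap. An undefined one says that Bob always misses the
        -- group, so `hard-miss` applies with size at most K + 1.
        answer≤ : ∀ i m → Possible (message x (i , x i)) m →
          𝔼 (answer m (i , x i)) (value (f (i , x i))) ≤ fromℕ (bound i m)
        answer≤ i m m? with T m i | knows m (short (i , x i) m m?) i
        ... | just _ | _ = 𝔼-≤ (answer m (i , x i)) λ S _ →
          fromℕ-mono-≤ (ℕ.≤-trans (hard≤ (i , x i) S) K*3≤)
          where
          K*3≤ : K ℕ.* 3 ℕ.≤ K ℕ.+ suc K ℕ.+ 1 ℕ.* K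
          K*3≤ = ℕ.≤-trans (ℕ.n≤1+n _) (ℕ.≤-reflexive
            (solve 1 (λ k → con 1 :+ k :* con 3 := k :+ (con 1 :+ k) :+ con 1 :* k) refl K))
            where open ℕSolver
        ... | nothing | unhit = 𝔼-≤ (answer m (i , x i)) λ S S? →
          fromℕ-mono-≤ (ℕ.≤-trans (hard-miss (i , x i) S (λ hit → unhit (x i) (S , S? , hit)))
            (ℕ.≤-trans (ℕ.+-monoʳ-≤ K (proj₂ (feasible P a 1 (chosen x) ⊤ (f (i , x i)) m S m? S?)))
              (ℕ.m≤m+n (K ℕ.+ suc K) 0)))

        opt : ∀ i → IsOptimum (suc K) (f (i , x i)) (chosen x ++ ⊤) (fromℕ (K ℕ.* 3))
        opt i = (best (i , x i) , (best⊆ x i , ∣best∣ (i , x i)) , reflexive (cong fromℕ (hard-best (i , x i))))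
              , λ S _ → fromℕ-mono-≤ (hard≤ (i , x i) S)

        each : ∀ i → ρ * fromℕ (K ℕ.* 3) ≤ 𝔼 (message x q₀) (fromℕ ∘ bound i)
        each i = begin
          ρ * fromℕ (K ℕ.* 3)                                      ≲⟨ approx a 1 (chosen x) ⊤ (f (i , x i)) _ (opt i) ⟩
          expectedValue P a 1 (chosen x) ⊤ (f (i , x i))           ≲⟨ 𝔼-mono (message x (i , x i)) (answer≤ i) ⟩
          -- For fixed `i` the bound is a function of the message alone, so only the law of the
          -- message has to be exchanged.
          𝔼 (message x (i , x i)) (fromℕ ∘ bound i)                ≈⟨ sameMessage x (i , x i) q₀ (fromℕ ∘ bound i) ⟩
          𝔼 (message x q₀) (fromℕ ∘ bound i)                       ∎
          where open ≤-Reasoning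

        -- Each defined entry costs an extra `K`, and by `few` there are at most `C` of them.
        total≤ : ∀ m → Possible (message x q₀) m →
          sum (λ i → fromℕ (bound i m)) ≤ fromℕ (n ℕ.* (K ℕ.+ suc K) ℕ.+ C ℕ.* K)
        total≤ m m? = ≤-trans (≤-reflexive (fromℕ-sum (λ i → bound i m)))
          (fromℕ-mono-≤ (ℕ.≤-trans (ℕ.≤-reflexive total≡)
            (ℕ.+-monoʳ-≤ (n ℕ.* (K ℕ.+ suc K)) (ℕ.*-monoˡ-≤ K (few m m?)))))
          where
          total≡ : SubmodularRanks.sum (λ i → bound i m) ≡ n ℕ.* (K ℕ.+ suc K) ℕ.+ sizeᵖ (T m) ℕ.* K
          total≡ = trans (SubmodularRanks.∑-distrib-+ {n} (const (K ℕ.+ suc K)) _)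
            (cong₂ ℕ._+_ (SubmodularRanks.sum-const n (K ℕ.+ suc K))
              (sym (SemiringSum.*-distribʳ-sum ℕ.+-*-semiring K (defined ∘ T m))))

        all-pairs : fromℕ n * (ρ * fromℕ (K ℕ.* 3)) ≤ fromℕ (n ℕ.* (K ℕ.+ suc K) ℕ.+ C ℕ.* K)
        all-pairs = begin
          fromℕ n * (ρ * fromℕ (K ℕ.* 3))                            ≈⟨ sum-const n _ ⟨
          sum {n} (const (ρ * fromℕ (K ℕ.* 3)))                      ≲⟨ sum-mono-≤ each ⟩
          sum (λ i → 𝔼 (message x q₀) (fromℕ ∘ bound i))             ≈⟨ sum-𝔼 (message x q₀) (λ i → fromℕ ∘ bound i) ⟩
          𝔼 (message x q₀) (λ m → sum λ i → fromℕ (bound i m))       ≲⟨ 𝔼-≤ (message x q₀) total≤ ⟩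
          fromℕ (n ℕ.* (K ℕ.+ suc K) ℕ.+ C ℕ.* K)                    ∎
          where open ≤-Reasoning

    -- Since x ≤ y is a negation, T may be chosen classically.
    pairs-bound : fromℕ n * (ρ * fromℕ (K ℕ.* 3)) ≤ fromℕ (n ℕ.* (K ℕ.+ suc K) ℕ.+ C ℕ.* K)
    pairs-bound lt = ¬¬-choice-strings C (λ m → ¬¬-choice-Fin (¬¬knows m)) λ (T , knows) →
      all-pairs T knows lt

-- Indexing Alice's elements by pair, side and layer.

module Arrangement (n-1 K-1 r : ℕ) where
  open import Data.Nat.Base using (_+_; _*_)

  -- Both `n` and `K` are successors, so the element zero that serves as default in `locate` exists.
  n K a : ℕ
  n = suc n-1
  K = suc K-1
  a = n * (2 * K) + r

  open Inverse Fin.2↔Bool using () renaming (to to toBool; from to fromBool; strictlyInverseˡ to toBool-fromBool)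

  relabel : Fin n × (Fin 2 × Fin K) → (Fin n × Bool) × Fin K
  relabel (i , b , t) = (i , toBool b) , t

  decode : Fin (n * (2 * K)) → (Fin n × Bool) × Fin K
  decode = relabel ∘ map₂ (remQuot {2} K) ∘ remQuot {n} (2 * K)

  -- The last r elements are superfluous; they get the group and layer of element zero.
  locate : Fin a → (Fin n × Bool) × Fin K
  locate p = decode ([ id , const zero ]′ (splitAtᶠ (n * (2 * K)) p))

  element : Fin n × Bool → Fin K → Fin a
  element (i , β) t = combine i (combine (fromBool β) t) ↑ˡ r

  locate-element : ∀ q t → locate (element q t) ≡ (q , t)
  locate-element (i , β) t = begin
    locate (element (i , β) t)
      ≡⟨ cong (decode ∘ [ id , const zero ]′)
           (Fin.splitAt-↑ˡ (n * (2 * K)) (combine i (combine (fromBool β) t)) r) ⟩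
    decode (combine i (combine (fromBool β) t))
      ≡⟨ cong (relabel ∘ map₂ (remQuot {2} K)) (Fin.remQuot-combine i (combine (fromBool β) t)) ⟩
    relabel (i , remQuot {2} K (combine (fromBool β) t))
      ≡⟨ cong (relabel ∘ (i ,_)) (Fin.remQuot-combine (fromBool β) t) ⟩
    ((i , toBool (fromBool β)) , t)
      ≡⟨ cong (λ b → (i , b) , t) (toBool-fromBool β) ⟩
    ((i , β) , t) ∎
    where open ≡-Reasoning

-- Here `q` and `r` are quotient and remainder of `N` by the size of a pair. Rounding costs a factor
-- 2, since q + 1 ≤ 2n holds for n = q ≥ 1 as well as for q = 0 and n = 1; the two groups of a pair
-- account for the other factor 2.
N≤4kn : ∀ K q n r {N} → suc q ℕ.≤ 2 ℕ.* n → N ≡ r ℕ.+ q ℕ.* (2 ℕ.* suc K) → r ℕ.< 2 ℕ.* suc K →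
  suc N ℕ.≤ 4 ℕ.* suc (suc K) ℕ.* n
N≤4kn K q n r {N} q<2n refl r<M = begin
  suc r ℕ.+ q ℕ.* (2 ℕ.* suc K)         ≤⟨ ℕ.+-monoˡ-≤ (q ℕ.* (2 ℕ.* suc K)) r<M ⟩
  suc q ℕ.* (2 ℕ.* suc K)               ≤⟨ ℕ.*-monoˡ-≤ (2 ℕ.* suc K) q<2n ⟩
  2 ℕ.* n ℕ.* (2 ℕ.* suc K)             ≤⟨ ℕ.*-monoʳ-≤ (2 ℕ.* n) (ℕ.*-monoʳ-≤ 2 (ℕ.n≤1+n (suc K))) ⟩
  2 ℕ.* n ℕ.* (2 ℕ.* suc (suc K))       ≡⟨ solve 2 (λ n k → con 2 :* n :* (con 2 :* k) := con 4 :* k :* n)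
                                             refl n (suc (suc K)) ⟩
  4 ℕ.* suc (suc K) ℕ.* n               ∎
  where
  open ℕ.≤-Reasoning
  open ℕSolver

-- From the summed guarantee to the bound in terms of `N`, `ε` and `k`.

module Rates {c ℓ} (F : OrderedField c ℓ) where
  open OrderedField F hiding (zero)
  open OrderedFieldProperties F
  open Solver commutativeSemiring using (solve; _:+_; _:*_; _:=_; con)

  -- Let L be `suc K`, so that k = L + 1. Cancelling 2nL leaves 3nεL ≤ CL + n. From 1 ≤ kε and k ≤
  -- 2L follows n ≤ 2nεL, so two of the three copies of nεL pay for n, and L cancels.
  rate : ∀ n K C ε → 0# < ε → 1# ≤ fromℕ (suc (suc K)) * ε →
    fromℕ n * ((fromℕ 2 /ℕ 3 + ε) * fromℕ (suc K ℕ.* 3)) ≤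
      fromℕ (n ℕ.* (suc K ℕ.+ suc (suc K)) ℕ.+ C ℕ.* suc K) →
    fromℕ n * ε ≤ fromℕ C
  rate n K-1 C ε 0<ε 1≤kε hyp = *-cancelʳ-≤ (fromℕ-pos K-1) (+-cancelʳ-≤ (X + X) (begin
    X + (X + X)         ≲⟨ +-cancelʳ-≤ (n̂ * K̂ * fromℕ 2) cancelled ⟩
    Ĉ * K̂ + n̂           ≲⟨ +-monoʳ-≤ (Ĉ * K̂) n≤2X ⟩
    Ĉ * K̂ + (X + X)     ∎))
    where
    open ≤-Reasoning
    K = suc K-1
    n̂ = fromℕ n
    K̂ = fromℕ K
    Ĉ = fromℕ C
    q = fromℕ 2 /ℕ 3
    X = n̂ * ε * K̂

    cancelled : X + (X + X) + n̂ * K̂ * fromℕ 2 ≤ Ĉ * K̂ + n̂ + n̂ * K̂ * fromℕ 2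
    cancelled = begin
      X + (X + X) + n̂ * K̂ * fromℕ 2
        ≈⟨ +-congˡ (*-congˡ (/ℕ-cancel (fromℕ 2) 3)) ⟨
      X + (X + X) + n̂ * K̂ * (q * fromℕ 3)
        ≈⟨ solve 4 (λ n K e q → n :* e :* K :+ (n :* e :* K :+ n :* e :* K)
                      :+ n :* K :* (q :* three)
                    := n :* ((q :+ e) :* (K :* three))) ≈-refl n̂ K̂ ε q ⟩
      n̂ * ((q + ε) * (K̂ * fromℕ 3))
        ≈⟨ *-congˡ (*-congˡ (fromℕ-* K 3)) ⟨
      n̂ * ((q + ε) * fromℕ (K ℕ.* 3))
        ≲⟨ hyp ⟩
      fromℕ (n ℕ.* (K ℕ.+ suc K) ℕ.+ C ℕ.* K)
        ≈⟨ ≈-trans (fromℕ-+ (n ℕ.* (K ℕ.+ suc K)) (C ℕ.* K)) (+-cong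
             (≈-trans (fromℕ-* n (K ℕ.+ suc K)) (*-congˡ (fromℕ-+ K (suc K)))) (fromℕ-* C K)) ⟩
      n̂ * (K̂ + (1# + K̂)) + Ĉ * K̂
        ≈⟨ solve 3 (λ n K C → n :* (K :+ (con 1 :+ K)) :+ C :* K
                    := C :* K :+ n :+ n :* K :* (con 1 :+ (con 1 :+ con 0))) ≈-refl n̂ K̂ Ĉ ⟩
      Ĉ * K̂ + n̂ + n̂ * K̂ * fromℕ 2 ∎
      where
      -- Nested to have the shape of the unfolded `fromℕ 3`.
      three : ∀ {m} → Solver.Polynomial commutativeSemiring m
      three = con 1 :+ (con 1 :+ (con 1 :+ con 0))

    n≤2X : n̂ ≤ X + X
    n≤2X = begin
      n̂                             ≈⟨ *-identityʳ n̂ ⟨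
      n̂ * 1#                        ≲⟨ *-monoʳ-≤ (fromℕ-nonNeg n) 1≤kε ⟩
      n̂ * ((1# + K̂) * ε)            ≈⟨ solve 3 (λ n K e → n :* ((con 1 :+ K) :* e) := n :* e :* con 1 :+ n :* e :* K)
                                         ≈-refl n̂ K̂ ε ⟩
      n̂ * ε * 1# + X                ≲⟨ +-monoˡ-≤ X (*-monoʳ-≤ (*-nonNeg (fromℕ-nonNeg n) (<⇒≤ 0<ε)) 1≤K) ⟩
      X + X                         ∎
      where
      1≤K : 1# ≤ K̂
      1≤K = x≤x+y 1# (fromℕ-nonNeg K-1)

  -- Multiplication by 4k clears both divisions and leaves Nε ≤ 4knε ≤ 4kC.
  scale : ∀ N k n C ε .{{_ : NonZero k}} → 0# < ε → N ℕ.≤ 4 ℕ.* k ℕ.* n → fromℕ n * ε ≤ fromℕ C →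
    (1# /ℕ 4) * ((fromℕ N * ε) /ℕ k) ≤ fromℕ C
  scale N k@(suc k-1) n C ε 0<ε N≤ nε≤C = *-cancelʳ-≤ (*-pos (fromℕ-pos 3) (fromℕ-pos k-1)) (begin
    (1# /ℕ 4) * ((fromℕ N * ε) /ℕ k) * (fromℕ 4 * fromℕ k)
      ≈⟨ solve 4 (λ q z f k → q :* z :* (f :* k) := (q :* f) :* (z :* k))
           ≈-refl (1# /ℕ 4) ((fromℕ N * ε) /ℕ k) (fromℕ 4) (fromℕ k) ⟩
    (1# /ℕ 4) * fromℕ 4 * (((fromℕ N * ε) /ℕ k) * fromℕ k)
      ≈⟨ *-cong (/ℕ-cancel 1# 4) (/ℕ-cancel (fromℕ N * ε) k) ⟩
    1# * (fromℕ N * ε)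
      ≈⟨ *-identityˡ _ ⟩
    fromℕ N * ε
      ≲⟨ *-monoˡ-≤ (<⇒≤ 0<ε) (fromℕ-mono-≤ N≤) ⟩
    fromℕ (4 ℕ.* k ℕ.* n) * ε
      ≈⟨ *-congʳ (≈-trans (fromℕ-* (4 ℕ.* k) n) (*-congʳ (fromℕ-* 4 k))) ⟩
    fromℕ 4 * fromℕ k * fromℕ n * ε
      ≈⟨ *-assoc (fromℕ 4 * fromℕ k) (fromℕ n) ε ⟩
    fromℕ 4 * fromℕ k * (fromℕ n * ε)
      ≲⟨ *-monoʳ-≤ (<⇒≤ (*-pos (fromℕ-pos 3) (fromℕ-pos k-1))) nε≤C ⟩
    fromℕ 4 * fromℕ k * fromℕ C
      ≈⟨ *-comm _ _ ⟩
    fromℕ C * (fromℕ 4 * fromℕ k) ∎)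
    where open ≤-Reasoning

-- Protocols whose only message is the empty one.

module Silent {c ℓ} (ℝ : RealNumbers c ℓ) where
  open RealNumbers ℝ hiding (zero)
  open TwoPlayer ℝ
  open OrderedFieldProperties orderedField
  open TwoPlayerProperties ℝ
  open SubmodularRanks using (truncate; modular; ones; linear; linear-ones; ∣++∣)

  -- Without communication Bob cannot tell whether Alice has an element at all.
  communication≢0 : ∀ {k} ρ → 0# < ρ → (P : Protocol (suc k)) → ApproximationGuarantee P ρ →
    ∀ N → ¬ CommunicationAtMost P (suc N) 0
  communication≢0 {k} ρ 0<ρ P approx N silent =
    possible (message ⊥) λ (m , m?) → bounded (subst (Possible (message ⊥)) (empty ⊥ m m?) m?)
      (<-respʳ-≈ (≈-sym (≈-trans (*-congˡ (+-identityʳ 1#)) (*-identityʳ ρ))) 0<ρ)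
    where
    a = suc N

    -- All elements belong to Alice's side, and `f` is 0 on the empty set and 1 on all others.
    f : SubmodularFunction (a ℕ.+ 0)
    f = realize (truncate 1 (modular ones))

    message : Subset a → Random Message
    message V = alice P a 0 V (restrictᴬ a 0 f)

    empty : ∀ V m → Possible (message V) m → m ≡ []
    empty V m m? with m | silent a 0 (ℕ.+-identityʳ a) V f m m?
    ... | [] | _ = refl

    single : Subset (a ℕ.+ 0)
    single = ⁅ zero ⁆ ++ []

    ∣single∣ : ∣ single ∣ ≡ 1
    ∣single∣ = trans (∣++∣ {a} ⁅ zero ⁆ []) (trans (ℕ.+-identityʳ _) (∣⁅x⁆∣≡1 {a} zero))

    opt : IsOptimum (suc k) f single (fromℕ 1)
    opt = (single , (id , ℕ.≤-trans (ℕ.≤-reflexive ∣single∣) (s≤s z≤n))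
                  , reflexive (cong (λ s → fromℕ (1 ℕ.⊓ s)) (trans (linear-ones single) ∣single∣)))
        , λ S _ → fromℕ-mono-≤ (ℕ.m⊓n≤m 1 (linear ones S))

    worthless : ∀ S → S ⊆ ⊥ {a} ++ [] → value f S ≤ 0#
    worthless S S⊆⊥ = fromℕ-mono-≤ (begin
      1 ℕ.⊓ linear ones S ≤⟨ ℕ.m⊓n≤n 1 _ ⟩
      linear ones S       ≡⟨ linear-ones S ⟩
      ∣ S ∣               ≤⟨ p⊆q⇒∣p∣≤∣q∣ S⊆⊥ ⟩
      ∣ ⊥ {a} ++ [] ∣     ≡⟨ trans (∣++∣ (⊥ {a}) []) (trans (ℕ.+-identityʳ _) (∣⊥∣≡0 a)) ⟩
      0                   ∎)
      where open ℕ.≤-Reasoning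

    -- After the empty message Bob answers alike for Alice's sets `⁅ zero ⁆` and `⊥`, and
    -- feasibility for `⊥` leaves him only the empty set.
    bounded : Possible (message ⊥) [] → ρ * fromℕ 1 ≤ 0#
    bounded []? = ≤-trans (approx a 0 ⁅ zero ⁆ [] f (fromℕ 1) opt)
      (𝔼-≤ (message ⁅ zero ⁆) λ m m? → 𝔼-≤ (bob P a 0 [] m f) λ S S? → worthless S
        (proj₁ (feasible P a 0 ⊥ [] f [] S []?
          (subst (λ m → Possible (bob P a 0 [] m f) S) (empty ⁅ zero ⁆ m m?) S?))))

-- The communication bound for every ground set size, with constant 1/4.

theorem2 : ∀ {c ℓ} (ℝ : RealNumbers c ℓ) →
    let open RealNumbers ℝ
        open TwoPlayer ℝ
    in
    ∃ λ (κ : Carrier) → (0# < κ) ×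
      (∀ (ε : Carrier) (0<ε : 0# < ε) → ε < 1# /ℕ 4 →
       ∀ (k : ℕ) .{{_ : NonZero k}} → inv ε 0<ε ≤ fromℕ k →
       ∀ (P : Protocol k) → ApproximationGuarantee P (fromℕ 2 /ℕ 3 + ε) →
       ∀ (N C : ℕ) → CommunicationAtMost P N C →
       κ * ((fromℕ N * ε) /ℕ k) ≤ fromℕ C)
theorem2 ℝ = 1# /ℕ 4 , 0<κ , bound
  where
  open RealNumbers ℝ hiding (zero)
  open TwoPlayer ℝ
  open OrderedFieldProperties orderedField
  open TwoPlayerProperties ℝ
  open Rates orderedField
  open Silent ℝ

  0<κ : 0# < 1# /ℕ 4
  0<κ = /ℕ-pos 0<1 4

  bound : ∀ (ε : Carrier) (0<ε : 0# < ε) → ε < 1# /ℕ 4 →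
    ∀ (k : ℕ) .{{_ : NonZero k}} → inv ε 0<ε ≤ fromℕ k →
    ∀ (P : Protocol k) → ApproximationGuarantee P (fromℕ 2 /ℕ 3 + ε) →
    ∀ (N C : ℕ) → CommunicationAtMost P N C →
    (1# /ℕ 4) * ((fromℕ N * ε) /ℕ k) ≤ fromℕ C
  bound ε 0<ε ε<¼ k 1/ε≤k P approx N C comm = go k P approx N comm 1≤kε
    where
    1≤kε : 1# ≤ fromℕ k * ε
    1≤kε = ≤-trans (≤-reflexive (≈-trans (≈-sym (*-inverseʳ ε 0<ε)) (*-comm ε _))) (*-monoˡ-≤ (<⇒≤ 0<ε) 1/ε≤k)

    ε<1 : ε < 1#
    ε<1 = <-≤-trans ε<¼ (*-cancelʳ-≤ (fromℕ-pos 3) (begin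
      (1# /ℕ 4) * fromℕ 4 ≈⟨ /ℕ-cancel 1# 4 ⟩
      1#                  ≲⟨ x≤x+y 1# (fromℕ-nonNeg 3) ⟩
      fromℕ 4             ≈⟨ *-identityˡ (fromℕ 4) ⟨
      1# * fromℕ 4        ∎))
      where open ≤-Reasoning

    ε≤C : ∀ C → C ≢ 0 → fromℕ 1 * ε ≤ fromℕ C
    ε≤C zero    C≢0 = contradiction refl C≢0
    ε≤C (suc C) _   = begin
      fromℕ 1 * ε ≈⟨ *-congʳ (+-identityʳ 1#) ⟩
      1# * ε      ≈⟨ *-identityˡ ε ⟩
      ε           ≲⟨ <⇒≤ ε<1 ⟩
      1#          ≲⟨ x≤x+y 1# (fromℕ-nonNeg C) ⟩
      fromℕ (suc C) ∎
      where open ≤-Reasoning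

    go : ∀ k .{{_ : NonZero k}} (P : Protocol k) → ApproximationGuarantee P (fromℕ 2 /ℕ 3 + ε) →
      ∀ N → CommunicationAtMost P N C → 1# ≤ fromℕ k * ε → (1# /ℕ 4) * ((fromℕ N * ε) /ℕ k) ≤ fromℕ C
    -- Since ε < 1, the inequality 1 ≤ kε excludes k = 0 and k = 1, so there is at least one layer.
    go zero _ _ _ _ 1≤kε = contradiction (<-respˡ-≈ (≈-sym (zeroˡ ε)) 0<1) 1≤kε
    go (suc zero) _ _ _ _ 1≤kε = contradiction
      (<-respˡ-≈ (≈-sym (≈-trans (*-congʳ (+-identityʳ 1#)) (*-identityˡ ε))) ε<1) 1≤kε
    go k@(suc (suc K)) P approx zero comm 1≤kε =
      scale 0 k 0 C ε 0<ε z≤n (≤-trans (≤-reflexive (zeroˡ ε)) (fromℕ-nonNeg C))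
    -- One element is set aside for Bob; the other `N` are divided into pairs of groups with
    -- `2 * suc K` elements per pair.
    go k@(suc (suc K)) P approx (suc N) comm 1≤kε
      with N ℕ./ (2 ℕ.* suc K) | N ℕ.% (2 ℕ.* suc K)
         | ℕ.m≡m%n+[m/n]*n N (2 ℕ.* suc K) | ℕ.m%n<n N (2 ℕ.* suc K)
    -- There is no full pair here. Taking n = 1 in `scale` leaves ε ≤ C, which follows from C ≥ 1.
    ... | zero  | r | N≡ | r< = scale (suc N) k 1 C ε 0<ε (N≤4kn K 0 1 r (s≤s z≤n) N≡ r<)
      (ε≤C C λ { refl → communication≢0 _ 0<ρ P approx N comm })
      where
      0<ρ : 0# < fromℕ 2 /ℕ 3 + ε
      0<ρ = <-≤-trans (/ℕ-pos (fromℕ-pos 1) 3) (x≤x+y _ (<⇒≤ 0<ε))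
    ... | suc n | r | N≡ | r< = scale (suc N) k (suc n) C ε 0<ε
      (N≤4kn K (suc n) (suc n) r (ℕ.+-mono-≤ (s≤s (z≤n {n})) (ℕ.m≤m+n (suc n) 0)) N≡ r<)
      (rate (suc n) K C ε 0<ε 1≤kε
        (pairs-bound (suc K) P _ approx (suc N) C comm a (suc n)
          (trans (ℕ.+-comm a 1) (cong suc (trans (ℕ.+-comm (suc n ℕ.* (2 ℕ.* suc K)) r) (sym N≡))))
          (proj₁ ∘ locate) (proj₂ ∘ locate) element
          (λ q t → cong proj₁ (locate-element q t)) (λ q t → cong proj₂ (locate-element q t))
          -- Any group can serve as the reference `q₀`.
          (zero , true)))
      where open Arrangement n K r using (a; locate; element; locate-element)
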